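{- Let $N\ge2$, $0<\varepsilon\le\frac1{10}$, $0<\eta\le\frac13$, $\lambda=\frac{\varepsilon^2}{8N}$ and $\tilde p=32\frac{N^2}{\varepsilon^3\eta}\ln(N/\varepsilon)$. Take any SLAs $\beta(1),\dots,\beta(N)$ with $\sum_i\beta(i)\le1$ and $\beta(i)\ge e^{\eta(1+\lambda)}\frac{\varepsilon}{N}$ for all $i$, and any loads $L_1,\dots,L_T\in\mathbb{R}_{\ge0}^N$. Then for any user $i$ and any time $t\le T-\tilde p$, if $h_1',\dots,h_T'$ are allocations with $h_\tau'(i)=(1-2\varepsilon)\beta(i)$ for all $\tau$, the work done by Algorithm 1 (defined in the context, run with parameters $\varepsilon,\eta$) for user $i$ satisfies $$\sum_{\tau=1}^{t+\tilde p}w_\tau(i)\ \ge\ \sum_{\tau=1}^{t}w_\tau'(i),$$ where $w_\tau'$ is the work done by the allocations $h_1',\dots,h_T'$ on the same loads. Moreover, $\sum_{\tau=1}^t w_\tau(i)\ge\sum_{\tau=1}^t w_\tau'(i)-\beta(i)\tilde p$ for every $1\le t\le T$. (A sum up to $t+\tilde p$ is over all integers $\tau$ with $1\le\tau\le t+\tilde p$.)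
   Context: Model. There are $N\ge 2$ users sharing one resource of capacity $1$ over discrete times $t=1,\dots,T$. User $i$ has an SLA $\beta(i)\ge 0$. At time $t$ a load $L_t(i)\ge 0$ arrives for user $i$. Given allocations $h_1,\dots,h_T\in[0,1]^N$, the work and the queues are defined by $Q_1(i)=0$ and $$w_t(i)=\min\{h_t(i),\,L_t(i)+Q_t(i)\},\qquad Q_{t+1}(i)=\max\{0,\,L_t(i)+Q_t(i)-h_t(i)\}.$$ At time $t$ the only feedback is the set of active users $A_t=\{i: Q_t(i)>0\}$ and inactive users $B_t=\{1,\dots,N\}\setminus A_t$. Truncated simplex and projection. $\Delta_\varepsilon=\{x\in\mathbb{R}^N:\sum_i x(i)=1,\ x(i)\ge\varepsilon/N\ \forall i\}$, and for $y$ with positive entries $\pi_{\Delta_\varepsilon}(y)=\operatorname{argmin}_{x\in\Delta_\varepsilon}\sum_i x(i)\log(x(i)/y(i))$. Algorithm 1 (parameters $\varepsilon,\eta$). Set $\lambda=\frac{\varepsilon^2}{8N}$ and let $h_1$ be any element of $\Delta_\varepsilon$. For $t=1,\dots,T$: use allocation $h_t$; read $A_t,B_t$; let $A_t^1=\{i\in A_t:h_t(i)<\beta(i)\}$ and $A_t^2=A_t\setminus A_t^1$; set $g_t(i)=1+\lambda$ for $i\in A_t^1$, $g_t(i)=1$ for $i\in A_t^2$, $g_t(i)=0$ for $i\in B_t$; set $\widehat h_{t+1}(i)=h_t(i)e^{\eta g_t(i)}$ and $h_{t+1}=\pi_{\Delta_\varepsilon}(\widehat h_{t+1})$. -}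

module Defs where

open import Algebra.Bundles using (CommutativeRing; module Semiring)
open import Data.Bool.Base using (if_then_else_)
open import Data.Fin.Base using (Fin; toℕ)
open import Data.Nat.Base as ℕ using (ℕ; zero; suc; _!)
open import Data.Product.Base using (_×_; ∃-syntax)
open import Level using (Level) renaming (_⊔_ to _⊔ˡ_; suc to lsuc)
open import Relation.Binary.Bundles using (DecTotalOrder)
open import Relation.Binary.Core using (Rel)
open import Relation.Binary.Definitions using (Decidable)
open import Relation.Binary.Structures using (IsDecTotalOrder)
open import Relation.Nullary.Decidable.Core using (does)

-- The classical real numbers, given axiomatically as the Dedekind-complete
-- ordered field (unique up to unique isomorphism). The order is decidable.

record RealNumbers (c ℓ₁ ℓ₂ : Level) : Set (lsuc (c ⊔ˡ ℓ₁ ⊔ˡ ℓ₂)) where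
  infix 4 _≤_
  infix 9 _⁻¹
  field
    commutativeRing : CommutativeRing c ℓ₁

  open CommutativeRing commutativeRing public

  field
    _≤_             : Rel Carrier ℓ₂
    isDecTotalOrder : IsDecTotalOrder _≈_ _≤_

    -- The value of 0# ⁻¹ is unspecified.
    _⁻¹        : Carrier → Carrier
    ⁻¹-inverse : ∀ x → x ≉ 0# → x * x ⁻¹ ≈ 1#
    0≉1        : 0# ≉ 1#

    +-mono-≤   : ∀ x y z → x ≤ y → x + z ≤ y + z
    *-nonneg   : ∀ x y → 0# ≤ x → 0# ≤ y → 0# ≤ x * y

  IsUpperBound : (Carrier → Set (c ⊔ˡ ℓ₁ ⊔ˡ ℓ₂)) → Carrier → Set (c ⊔ˡ ℓ₁ ⊔ˡ ℓ₂)
  IsUpperBound P b = ∀ x → P x → x ≤ b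

  field
    supremum : (P : Carrier → Set (c ⊔ˡ ℓ₁ ⊔ˡ ℓ₂)) →
               ∃[ x ] P x → ∃[ b ] IsUpperBound P b →
               ∃[ s ] (IsUpperBound P s × (∀ b → IsUpperBound P b → s ≤ b))

  decTotalOrder : DecTotalOrder c ℓ₁ ℓ₂
  decTotalOrder = record { isDecTotalOrder = isDecTotalOrder }

  open DecTotalOrder decTotalOrder public using (totalOrder; _≤?_; _≟_)
  open import Relation.Binary.Properties.DecTotalOrder decTotalOrder public
    using (_<_)
  open import Relation.Binary.Construct.NonStrictToStrict _≈_ _≤_
    using (<-decidable)
  open import Algebra.Construct.NaturalChoice.Min totalOrder public using (_⊓_)
  open import Algebra.Construct.NaturalChoice.Max totalOrder public using (_⊔_)
  open import Algebra.Definitions.RawSemiring (Semiring.rawSemiring semiring) public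
    using (_^_)
    renaming (_×_ to _·_)
  open import Algebra.Properties.Monoid.Sum +-monoid public
    using (sum; sum-syntax)

  infix 4 _<?_
  _<?_ : Decidable _<_
  _<?_ = <-decidable _≟_ _≤?_

  infixl 7 _/_
  _/_ : Carrier → Carrier → Carrier
  x / y = x * y ⁻¹

  fromℕ : ℕ → Carrier
  fromℕ n = n · 1#

  infix 4 _⟶_
  _⟶_ : (ℕ → Carrier) → Carrier → Set (c ⊔ˡ ℓ₁ ⊔ˡ ℓ₂)
  a ⟶ x = ∀ δ → 0# < δ →
    ∃[ n₀ ] (∀ n → n₀ ℕ.≤ n → (a n - x < δ) × (x - a n < δ))

-- exp is determined by its power series, log as the inverse of exp on the
-- positive reals; the values of log elsewhere are unspecified.

record ExpLog {c ℓ₁ ℓ₂} (R : RealNumbers c ℓ₁ ℓ₂) : Set (c ⊔ˡ ℓ₁ ⊔ˡ ℓ₂) where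
  open RealNumbers R
  field
    exp        : Carrier → Carrier
    exp-series : ∀ x → (λ n → ∑[ k < n ] (x ^ toℕ k / fromℕ (toℕ k !))) ⟶ exp x
    log        : Carrier → Carrier
    exp-log    : ∀ x → 0# < x → exp (log x) ≈ x

-- Times are counted from 0: index s stands for time s + 1 of the model, so
-- that the times 1, …, T are the indices s < T and a sum over the times
-- 1, …, t is a sum over s < t.  Loads and allocations are total functions of
-- the index, but only their values at indices s < T matter.

module Allocation {c ℓ₁ ℓ₂} (R : RealNumbers c ℓ₁ ℓ₂) (E : ExpLog R) (N : ℕ) where
  open RealNumbers R
  open ExpLog E

  Allocations : Set c
  Allocations = ℕ → Fin N → Carrier

  Loads : Set c
  Loads = ℕ → Fin N → Carrier

  queue : Allocations → Loads → ℕ → Fin N → Carrier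
  queue h L zero    i = 0#
  queue h L (suc s) i = 0# ⊔ (L s i + queue h L s i - h s i)

  work : Allocations → Loads → ℕ → Fin N → Carrier
  work h L s i = h s i ⊓ (L s i + queue h L s i)

  record InSimplex (ε : Carrier) (x : Fin N → Carrier) : Set (ℓ₁ ⊔ˡ ℓ₂) where
    field
      total-one   : ∑[ i < N ] x i ≈ 1#
      lower-bound : ∀ i → ε / fromℕ N ≤ x i

  relativeEntropy : (x y : Fin N → Carrier) → Carrier
  relativeEntropy x y = ∑[ i < N ] (x i * log (x i / y i))

  record IsProjection (ε : Carrier) (y x : Fin N → Carrier) : Set (c ⊔ˡ ℓ₁ ⊔ˡ ℓ₂) where
    field
      inSimplex : InSimplex ε x
      minimal   : ∀ z → InSimplex ε z → relativeEntropy x y ≤ relativeEntropy z y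

  bonus : Carrier → Carrier
  bonus ε = ε ^ 2 / (fromℕ 8 * fromℕ N)

  gain : Carrier → (Fin N → Carrier) → Allocations → Loads → ℕ → Fin N → Carrier
  gain ε β h L s i =
    if does (0# <? queue h L s i)
      then (if does (h s i <? β i) then 1# + bonus ε else 1#)
      else 0#

  record IsRun (ε η : Carrier) (β : Fin N → Carrier) (L : Loads) (T : ℕ)
               (h : Allocations) : Set (c ⊔ˡ ℓ₁ ⊔ˡ ℓ₂) where
    field
      initial : InSimplex ε (h 0)
      update  : ∀ s → s ℕ.< T →
                IsProjection ε (λ i → h s i * exp (η * gain ε β h L s i)) (h (suc s))

  delay : Carrier → Carrier → Carrier
  delay ε η =
    fromℕ 32 * (fromℕ N ^ 2 / (ε ^ 3 * η)) * log (fromℕ N / ε)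

  -- The sum of f over all times τ ≤ x among 1, …, T.
  sumUpTo : ℕ → Carrier → (ℕ → Carrier) → Carrier
  sumUpTo T x f =
    ∑[ s < T ] (if does (fromℕ (suc (toℕ s)) ≤? x) then f (toℕ s) else 0#)

{-# OPTIONS --safe #-}
-- A user is active (has a nonempty queue) on intervals preceded by a time with an
-- empty queue; on such an interval its work equals its allocation, so it suffices
-- to bound the allocation from below there.  The entropic projection x of y
-- satisfies x a / y a ≤ x b / y b whenever x a is above the floor ε / N.  If an
-- active user i has less than β i, then some user j has more than β j, which is at
-- least e^{η(1+λ)} ε / N; user j does not get the bonus and loses share, and since
-- the shares sum to 1 this forces h i to grow by a factor at least 1 + ηλε/N.  So
-- h i reaches β i in fewer than delay ε η steps.  While the user stays active,
-- h i afterwards falls below β i only in a single step from above it, by a factor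
-- at least 1 - ηλ ≥ 1 - 2ε, and then grows again.
module Submission where

open import Defs
open import Algebra.Solver.Ring.AlmostCommutativeRing
  using (AlmostCommutativeRing; fromCommutativeRing; _-Raw-AlmostCommutative⟶_)
import Algebra.Solver.Ring
import Algebra.Properties.AbelianGroup
import Algebra.Properties.Ring
import Algebra.Properties.Semiring.Mult
import Algebra.Properties.Semiring.Exp
import Algebra.Properties.Semiring.Sum
open import Data.Bool.Base using (if_then_else_)
open import Data.Empty using (⊥-elim)
open import Data.Fin.Base using (Fin; zero; suc; toℕ)
import Data.Fin.Properties as Finₚ
open import Data.Integer.Base as ℤ using (ℤ; +_; -[1+_]; _⊖_; +-*-rawRing)
import Data.Integer.Properties as ℤₚ
import Data.Maybe.Base as Maybe
open import Data.Nat.Base as ℕ using (ℕ; zero; suc; _!)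
import Data.Nat.Properties as ℕₚ
open import Data.Product.Base using (_×_; _,_; proj₁; proj₂; ∃-syntax)
import Data.Sign.Base as Sign
open import Data.Sum.Base using (_⊎_; inj₁; inj₂; [_,_]′)
open import Function.Base using (_∘_)
open import Level as Level using (Level)
open import Relation.Binary.Bundles using (DecTotalOrder)
open import Relation.Binary.Structures using (IsDecTotalOrder)
import Relation.Binary.Properties.DecTotalOrder
import Relation.Binary.Reasoning.PartialOrder
import Relation.Binary.Reasoning.Setoid
open import Relation.Binary.PropositionalEquality.Core as ≡ using (_≡_)
open import Relation.Binary.Consequences using (dec⇒weaklyDec)
open import Relation.Nullary using (¬_; Dec; yes; no; does)

-- When a busy interval starts at `s`, the algorithm has served every load that arrived before `s`,
-- and the competitor cannot have served more of those. After `s` the competitor earns at most `ρ`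
-- per step, so both claims reduce to counting: all but `k` active steps pay at least `ρ`, the idle
-- step `s` may be lost as well, and k + 1 ≤ `p`. The constant 32 is 4 · 8. With `δ` = ηλε/N =
-- ηε³/(8N²) and `ℓ` = ln(N/ε), the delay is 4ℓ/δ. Growth from ε/N up to 1 by factors 1 + δ lasts at
-- most ℓ(1 + δ)/δ ≤ 2ℓ/δ steps. The other 2ℓ/δ cover two single steps: the idle one, and the one by
-- which the length of the warm-up exceeds its last exponent. The lower bound on β leaves user j at
-- least `δ` above the floor, which is the room needed to pay for the growth of user i. Two
-- obstacles shape the text. `exp` is known only through its series, so its functional equation has
-- to come from Cauchy products; and the projection is known only as a minimiser, so its first-order
-- condition comes from explicit small transfers of mass.

-- A ring solver with integer coefficients.

module IntegerCoefficients {c ℓ₁ ℓ₂} (R : RealNumbers c ℓ₁ ℓ₂) where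
  open RealNumbers R
  open Algebra.Properties.Ring ring using (-‿distribˡ-*; -‿distribʳ-*)
  open Algebra.Properties.AbelianGroup +-abelianGroup
    using (⁻¹-∙-comm; ⁻¹-involutive; ε⁻¹≈ε)
  open Algebra.Properties.Semiring.Mult semiring using (×-homo-+; ×1-homo-*)
  open Relation.Binary.Reasoning.Setoid setoid

  -- Unlike fromℕ, this sends the literal 1 to 1# itself rather than to 1# + 0#.
  ⟦_⟧ₙ : ℕ → Carrier
  ⟦ 1 ⟧ₙ = 1#
  ⟦ n ⟧ₙ = fromℕ n

  ⟦_⟧ : ℤ → Carrier
  ⟦ + n ⟧      = ⟦ n ⟧ₙ
  ⟦ -[1+ n ] ⟧ = - ⟦ suc n ⟧ₙ

  ⟦⟧ₙ≈fromℕ : ∀ n → ⟦ n ⟧ₙ ≈ fromℕ n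
  ⟦⟧ₙ≈fromℕ 0             = refl
  ⟦⟧ₙ≈fromℕ 1             = sym (+-identityʳ 1#)
  ⟦⟧ₙ≈fromℕ (suc (suc n)) = refl

  ⟦⟧-neg : ∀ i → ⟦ ℤ.- i ⟧ ≈ - ⟦ i ⟧
  ⟦⟧-neg (+ zero)  = sym ε⁻¹≈ε
  ⟦⟧-neg (+ suc n) = refl
  ⟦⟧-neg -[1+ n ]  = sym (⁻¹-involutive _)

  ⟦⟧-⊖ : ∀ m n → ⟦ m ⊖ n ⟧ ≈ fromℕ m - fromℕ n
  ⟦⟧-⊖ m       zero    = begin
    ⟦ m ⟧ₙ         ≈⟨ ⟦⟧ₙ≈fromℕ m ⟩
    fromℕ m        ≈⟨ +-identityʳ _ ⟨
    fromℕ m + 0#   ≈⟨ +-congˡ ε⁻¹≈ε ⟨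
    fromℕ m - 0#   ∎
  ⟦⟧-⊖ zero    (suc n) = trans (-‿cong (⟦⟧ₙ≈fromℕ (suc n))) (sym (+-identityˡ _))
  ⟦⟧-⊖ (suc m) (suc n) = begin
    ⟦ suc m ⊖ suc n ⟧                        ≡⟨ ≡.cong ⟦_⟧ (ℤₚ.[1+m]⊖[1+n]≡m⊖n m n) ⟩
    ⟦ m ⊖ n ⟧                                ≈⟨ ⟦⟧-⊖ m n ⟩
    fromℕ m - fromℕ n                        ≈⟨ +-congʳ (+-identityˡ _) ⟨
    (0# + fromℕ m) - fromℕ n                 ≈⟨ +-congʳ (+-congʳ (-‿inverseʳ 1#)) ⟨
    (1# - 1# + fromℕ m) - fromℕ n            ≈⟨ +-congʳ (+-assoc _ _ _) ⟩
    (1# + (- 1# + fromℕ m)) - fromℕ n        ≈⟨ +-congʳ (+-congˡ (+-comm _ _)) ⟩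
    (1# + (fromℕ m - 1#)) - fromℕ n          ≈⟨ +-congʳ (+-assoc _ _ _) ⟨
    (1# + fromℕ m - 1#) - fromℕ n            ≈⟨ +-assoc _ _ _ ⟩
    1# + fromℕ m + (- 1# - fromℕ n)          ≈⟨ +-congˡ (⁻¹-∙-comm _ _) ⟩
    1# + fromℕ m - (1# + fromℕ n)            ∎

  ⟦⟧-+ : ∀ i j → ⟦ i ℤ.+ j ⟧ ≈ ⟦ i ⟧ + ⟦ j ⟧
  ⟦⟧-+ (+ m) (+ n) = begin
    ⟦ m ℕ.+ n ⟧ₙ          ≈⟨ ⟦⟧ₙ≈fromℕ (m ℕ.+ n) ⟩
    fromℕ (m ℕ.+ n)       ≈⟨ ×-homo-+ 1# m n ⟩
    fromℕ m + fromℕ n     ≈⟨ +-cong (⟦⟧ₙ≈fromℕ m) (⟦⟧ₙ≈fromℕ n) ⟨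
    ⟦ m ⟧ₙ + ⟦ n ⟧ₙ       ∎
  ⟦⟧-+ (+ m) -[1+ n ] = begin
    ⟦ m ⊖ suc n ⟧             ≈⟨ ⟦⟧-⊖ m (suc n) ⟩
    fromℕ m - fromℕ (suc n)   ≈⟨ +-cong (⟦⟧ₙ≈fromℕ m) (-‿cong (⟦⟧ₙ≈fromℕ (suc n))) ⟨
    ⟦ m ⟧ₙ - ⟦ suc n ⟧ₙ       ∎
  ⟦⟧-+ -[1+ m ] (+ n) = begin
    ⟦ n ⊖ suc m ⟧             ≈⟨ ⟦⟧-⊖ n (suc m) ⟩
    fromℕ n - fromℕ (suc m)   ≈⟨ +-cong (⟦⟧ₙ≈fromℕ n) (-‿cong (⟦⟧ₙ≈fromℕ (suc m))) ⟨
    ⟦ n ⟧ₙ - ⟦ suc m ⟧ₙ       ≈⟨ +-comm _ _ ⟩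
    - ⟦ suc m ⟧ₙ + ⟦ n ⟧ₙ     ∎
  ⟦⟧-+ -[1+ m ] -[1+ n ] = begin
    - fromℕ (suc (suc (m ℕ.+ n)))        ≡⟨ ≡.cong (λ k → - fromℕ (suc k)) (ℕₚ.+-suc m n) ⟨
    - fromℕ (suc m ℕ.+ suc n)            ≈⟨ -‿cong (×-homo-+ 1# (suc m) (suc n)) ⟩
    - (fromℕ (suc m) + fromℕ (suc n))    ≈⟨ ⁻¹-∙-comm _ _ ⟨
    - fromℕ (suc m) - fromℕ (suc n)      ≈⟨ +-cong (-‿cong (⟦⟧ₙ≈fromℕ (suc m))) (-‿cong (⟦⟧ₙ≈fromℕ (suc n))) ⟨
    - ⟦ suc m ⟧ₙ - ⟦ suc n ⟧ₙ            ∎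

  ⟦⟧ₙ-* : ∀ m n → ⟦ m ℕ.* n ⟧ₙ ≈ ⟦ m ⟧ₙ * ⟦ n ⟧ₙ
  ⟦⟧ₙ-* m n = begin
    ⟦ m ℕ.* n ⟧ₙ          ≈⟨ ⟦⟧ₙ≈fromℕ (m ℕ.* n) ⟩
    fromℕ (m ℕ.* n)       ≈⟨ ×1-homo-* m n ⟩
    fromℕ m * fromℕ n     ≈⟨ *-cong (⟦⟧ₙ≈fromℕ m) (⟦⟧ₙ≈fromℕ n) ⟨
    ⟦ m ⟧ₙ * ⟦ n ⟧ₙ       ∎

  ⟦⟧-*-pos : ∀ m j → ⟦ + m ℤ.* j ⟧ ≈ ⟦ m ⟧ₙ * ⟦ j ⟧
  ⟦⟧-*-pos m (+ n) = trans (reflexive (≡.cong ⟦_⟧ (ℤₚ.+◃n≡+n (m ℕ.* n)))) (⟦⟧ₙ-* m n)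
  ⟦⟧-*-pos m -[1+ n ] = begin
    ⟦ Sign.- ℤ.◃ m ℕ.* suc n ⟧    ≡⟨ ≡.cong ⟦_⟧ (ℤₚ.-◃n≡-n (m ℕ.* suc n)) ⟩
    ⟦ ℤ.- (+ (m ℕ.* suc n)) ⟧     ≈⟨ ⟦⟧-neg (+ (m ℕ.* suc n)) ⟩
    - ⟦ m ℕ.* suc n ⟧ₙ            ≈⟨ -‿cong (⟦⟧ₙ-* m (suc n)) ⟩
    - (⟦ m ⟧ₙ * ⟦ suc n ⟧ₙ)       ≈⟨ -‿distribʳ-* _ _ ⟩
    ⟦ m ⟧ₙ * - ⟦ suc n ⟧ₙ         ∎

  ⟦⟧-* : ∀ i j → ⟦ i ℤ.* j ⟧ ≈ ⟦ i ⟧ * ⟦ j ⟧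
  ⟦⟧-* (+ m)    j = ⟦⟧-*-pos m j
  ⟦⟧-* -[1+ m ] j = begin
    ⟦ ℤ.- (+ suc m) ℤ.* j ⟧       ≡⟨ ≡.cong ⟦_⟧ (ℤₚ.neg-distribˡ-* (+ suc m) j) ⟨
    ⟦ ℤ.- (+ suc m ℤ.* j) ⟧       ≈⟨ ⟦⟧-neg (+ suc m ℤ.* j) ⟩
    - ⟦ + suc m ℤ.* j ⟧           ≈⟨ -‿cong (⟦⟧-*-pos (suc m) j) ⟩
    - (⟦ suc m ⟧ₙ * ⟦ j ⟧)        ≈⟨ -‿distribˡ-* _ _ ⟩
    - ⟦ suc m ⟧ₙ * ⟦ j ⟧          ∎

  almostCommutativeRing : AlmostCommutativeRing c ℓ₁
  almostCommutativeRing = fromCommutativeRing commutativeRing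

  -- Equality of integer coefficients is decided by computation, so the solver can collect and
  -- cancel numerals; numerals of the abstract field do not reduce.
  morphism : +-*-rawRing -Raw-AlmostCommutative⟶ almostCommutativeRing
  morphism = record
    { ⟦_⟧    = ⟦_⟧
    ; +-homo = ⟦⟧-+
    ; *-homo = ⟦⟧-*
    ; -‿homo = ⟦⟧-neg
    ; 0-homo = refl
    ; 1-homo = refl
    }

  open Algebra.Solver.Ring +-*-rawRing almostCommutativeRing morphism
    (λ i j → Maybe.map (λ i≡j → reflexive (≡.cong ⟦_⟧ i≡j)) (dec⇒weaklyDec ℤₚ._≟_ i j)) public
    using (solve; _:=_; con; _:+_; _:*_; _:-_; :-_; _:^_)

-- Arithmetic in an ordered field.

module OrderedField {c ℓ₁ ℓ₂} (R : RealNumbers c ℓ₁ ℓ₂) where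
  open RealNumbers R
  open IntegerCoefficients R public
    using (solve; _:=_; con; _:+_; _:*_; _:-_; :-_; _:^_)

  open IsDecTotalOrder isDecTotalOrder public
    using (antisym)
    renaming (refl to ≤-refl; reflexive to ≤-reflexive; trans to ≤-trans;
              total to ≤-total)
  open Relation.Binary.Properties.DecTotalOrder decTotalOrder public
    using (≰⇒>)

  module ≤-Reasoning = Relation.Binary.Reasoning.PartialOrder (DecTotalOrder.poset decTotalOrder)
  module ≈-Reasoning = Relation.Binary.Reasoning.Setoid setoid

  infix 4 _≼_
  -- The relation ∣x∣ ≤ X, expressed without an absolute value function.
  _≼_ : Carrier → Carrier → Set ℓ₂
  x ≼ X = (x ≤ X) × (- x ≤ X)

  abstract
    <⇒≤ : ∀ {x y} → x < y → x ≤ y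
    <⇒≤ = proj₁

    ≤-respʳ : ∀ {x y z} → y ≈ z → x ≤ y → x ≤ z
    ≤-respʳ y≈z x≤y = ≤-trans x≤y (≤-reflexive y≈z)

    ≤-respˡ : ∀ {x y z} → x ≈ y → x ≤ z → y ≤ z
    ≤-respˡ x≈y x≤z = ≤-trans (≤-reflexive (sym x≈y)) x≤z

    <-respʳ : ∀ {x y z} → y ≈ z → x < y → x < z
    <-respʳ y≈z (x≤y , x≉y) = ≤-respʳ y≈z x≤y , λ x≈z → x≉y (trans x≈z (sym y≈z))

    <-≤-trans : ∀ {x y z} → x < y → y ≤ z → x < z
    <-≤-trans (x≤y , x≉y) y≤z =
      ≤-trans x≤y y≤z , λ x≈z → x≉y (antisym x≤y (≤-respʳ (sym x≈z) y≤z))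

    ≤-<-trans : ∀ {x y z} → x ≤ y → y < z → x < z
    ≤-<-trans x≤y (y≤z , y≉z) =
      ≤-trans x≤y y≤z , λ x≈z → y≉z (antisym y≤z (≤-respˡ x≈z x≤y))

    <⇒≰ : ∀ {x y} → x < y → ¬ (y ≤ x)
    <⇒≰ (x≤y , x≉y) y≤x = x≉y (antisym x≤y y≤x)

    x≤y⇒0≤y-x : ∀ {x y} → x ≤ y → 0# ≤ y - x
    x≤y⇒0≤y-x {x} {y} x≤y = ≤-respˡ (-‿inverseʳ x) (+-mono-≤ x y (- x) x≤y)

    0≤y-x⇒x≤y : ∀ {x y} → 0# ≤ y - x → x ≤ y
    0≤y-x⇒x≤y {x} {y} p = ≤-respˡ (+-identityˡ x) (≤-respʳ
      (solve 2 (λ x y → y :- x :+ x := y) refl x y) (+-mono-≤ 0# (y - x) x p))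

    x<y⇒0<y-x : ∀ {x y} → x < y → 0# < y - x
    x<y⇒0<y-x {x} {y} (x≤y , x≉y) = x≤y⇒0≤y-x x≤y , λ 0≈y-x → x≉y (begin
      x            ≈⟨ +-identityˡ x ⟨
      0# + x       ≈⟨ +-congʳ 0≈y-x ⟩
      y - x + x    ≈⟨ solve 2 (λ x y → y :- x :+ x := y) refl x y ⟩
      y            ∎)
      where open ≈-Reasoning

    0<y-x⇒x<y : ∀ {x y} → 0# < y - x → x < y
    0<y-x⇒x<y {x} {y} (p , q) = 0≤y-x⇒x≤y p , λ x≈y → q (sym (trans (+-congʳ (sym x≈y)) (-‿inverseʳ x)))

    ≤-by : ∀ {x y e} → 0# ≤ e → y - x ≈ e → x ≤ y
    ≤-by 0≤e eq = 0≤y-x⇒x≤y (≤-respʳ (sym eq) 0≤e)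

    <-by : ∀ {x y e} → 0# < e → y - x ≈ e → x < y
    <-by 0<e eq = 0<y-x⇒x<y (<-respʳ (sym eq) 0<e)

    0≤x+y : ∀ {x y} → 0# ≤ x → 0# ≤ y → 0# ≤ x + y
    0≤x+y {x} {y} 0≤x 0≤y = ≤-trans 0≤x
      (≤-by 0≤y (solve 2 (λ x y → x :+ y :- x := y) refl x y))

    0<x+y : ∀ {x y} → 0# < x → 0# ≤ y → 0# < x + y
    0<x+y {x} {y} 0<x 0≤y = <-≤-trans 0<x
      (≤-by 0≤y (solve 2 (λ x y → x :+ y :- x := y) refl x y))

    0≤x*y : ∀ {x y} → 0# ≤ x → 0# ≤ y → 0# ≤ x * y
    0≤x*y = *-nonneg _ _

    +-mono : ∀ {x y u v} → x ≤ y → u ≤ v → x + u ≤ y + v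
    +-mono {x} {y} {u} {v} x≤y u≤v = ≤-by (0≤x+y (x≤y⇒0≤y-x x≤y) (x≤y⇒0≤y-x u≤v))
      (solve 4 (λ x y u v → y :+ v :- (x :+ u) := y :- x :+ (v :- u)) refl x y u v)

    +-mono-<-≤ : ∀ {x y u v} → x < y → u ≤ v → x + u < y + v
    +-mono-<-≤ {x} {y} {u} {v} x<y u≤v = <-by (0<x+y (x<y⇒0<y-x x<y) (x≤y⇒0≤y-x u≤v))
      (solve 4 (λ x y u v → y :+ v :- (x :+ u) := y :- x :+ (v :- u)) refl x y u v)

    x≈0 : ∀ {x y} → y ≉ 0# → x * y ≈ 0# → x ≈ 0#
    x≈0 {x} {y} y≉0 xy≈0 = begin
      x                ≈⟨ *-identityʳ x ⟨
      x * 1#           ≈⟨ *-congˡ (⁻¹-inverse y y≉0) ⟨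
      x * (y * y ⁻¹)   ≈⟨ *-assoc _ _ _ ⟨
      x * y * y ⁻¹     ≈⟨ *-congʳ xy≈0 ⟩
      0# * y ⁻¹        ≈⟨ zeroˡ _ ⟩
      0#               ∎
      where open ≈-Reasoning

    0<x*y : ∀ {x y} → 0# < x → 0# < y → 0# < x * y
    0<x*y (0≤x , 0≉x) (0≤y , 0≉y) =
      0≤x*y 0≤x 0≤y , λ 0≈xy → 0≉x (sym (x≈0 (0≉y ∘ sym) (sym 0≈xy)))

    *-monoˡ : ∀ {c x y} → 0# ≤ c → x ≤ y → c * x ≤ c * y
    *-monoˡ {c} {x} {y} 0≤c x≤y = ≤-by (0≤x*y 0≤c (x≤y⇒0≤y-x x≤y))
      (solve 3 (λ c x y → c :* y :- c :* x := c :* (y :- x)) refl c x y)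

    *-monoʳ : ∀ {c x y} → 0# ≤ c → x ≤ y → x * c ≤ y * c
    *-monoʳ {c} {x} {y} 0≤c x≤y = ≤-by (0≤x*y 0≤c (x≤y⇒0≤y-x x≤y))
      (solve 3 (λ c x y → y :* c :- x :* c := c :* (y :- x)) refl c x y)

    *-monoʳ-< : ∀ {c x y} → 0# < c → x < y → x * c < y * c
    *-monoʳ-< {c} {x} {y} 0<c x<y = <-by (0<x*y 0<c (x<y⇒0<y-x x<y))
      (solve 3 (λ c x y → y :* c :- x :* c := c :* (y :- x)) refl c x y)

    *-cancelʳ-≤ : ∀ {c x y} → 0# < c → x * c ≤ y * c → x ≤ y
    *-cancelʳ-≤ {c} {x} {y} 0<c xc≤yc with x ≤? y
    ... | yes x≤y = x≤y
    ... | no  x≰y = ⊥-elim (<⇒≰ (*-monoʳ-< 0<c (≰⇒> x≰y)) xc≤yc)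

    *-cancelʳ-< : ∀ {c x y} → 0# ≤ c → x * c < y * c → x < y
    *-cancelʳ-< {c} {x} {y} 0≤c xc<yc with y ≤? x
    ... | yes y≤x = ⊥-elim (<⇒≰ xc<yc (*-monoʳ 0≤c y≤x))
    ... | no  y≰x = ≰⇒> y≰x

    *-cancelʳ-≈ : ∀ {c x y} → 0# < c → x * c ≈ y * c → x ≈ y
    *-cancelʳ-≈ 0<c eq = antisym (*-cancelʳ-≤ 0<c (≤-reflexive eq)) (*-cancelʳ-≤ 0<c (≤-reflexive (sym eq)))

    0<1 : 0# < 1#
    0<1 with ≤-total 0# 1#
    ... | inj₁ 0≤1 = 0≤1 , 0≉1
    ... | inj₂ 1≤0 = ≤-respʳ (solve 0 ((con (+ 0) :- con (+ 1)) :* (con (+ 0) :- con (+ 1)) := con (+ 1)) refl)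
                       (0≤x*y (x≤y⇒0≤y-x 1≤0) (x≤y⇒0≤y-x 1≤0)) , 0≉1

    0≤fromℕ : ∀ n → 0# ≤ fromℕ n
    0≤fromℕ zero    = ≤-refl
    0≤fromℕ (suc n) = 0≤x+y (<⇒≤ 0<1) (0≤fromℕ n)

    0<fromℕ : ∀ n → .{{ℕ.NonZero n}} → 0# < fromℕ n
    0<fromℕ (suc n) = 0<x+y 0<1 (0≤fromℕ n)

    fromℕ-mono : ∀ {m n} → m ℕ.≤ n → fromℕ m ≤ fromℕ n
    fromℕ-mono {n = n} ℕ.z≤n = 0≤fromℕ n
    fromℕ-mono (ℕ.s≤s m≤n) = +-mono ≤-refl (fromℕ-mono m≤n)

    fromℕ-cancel : ∀ {m n} → fromℕ m ≤ fromℕ n → m ℕ.≤ n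
    fromℕ-cancel {m} {n} p with m ℕₚ.≤? n
    ... | yes m≤n = m≤n
    ... | no  m≰n = ⊥-elim (<⇒≰ (<-≤-trans n<1+n (fromℕ-mono (ℕₚ.≰⇒> m≰n))) p)
      where
      n<1+n : fromℕ n < 1# + fromℕ n
      n<1+n = <-by 0<1 (solve 1 (λ x → con (+ 1) :+ x :- x := con (+ 1)) refl (fromℕ n))

    x*x⁻¹≈1 : ∀ {x} → 0# < x → x * x ⁻¹ ≈ 1#
    x*x⁻¹≈1 (_ , 0≉x) = ⁻¹-inverse _ (0≉x ∘ sym)

    x/y*y≈x : ∀ {x y} → 0# < y → x / y * y ≈ x
    x/y*y≈x {x} {y} 0<y = begin
      x * y ⁻¹ * y     ≈⟨ solve 3 (λ x y z → x :* z :* y := x :* (y :* z)) refl x y (y ⁻¹) ⟩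
      x * (y * y ⁻¹)   ≈⟨ *-congˡ (x*x⁻¹≈1 0<y) ⟩
      x * 1#           ≈⟨ *-identityʳ x ⟩
      x                ∎
      where open ≈-Reasoning

    0<x⁻¹ : ∀ {x} → 0# < x → 0# < x ⁻¹
    0<x⁻¹ {x} 0<x = *-cancelʳ-< (<⇒≤ 0<x) (begin-strict
      0# * x       ≈⟨ zeroˡ x ⟩
      0#           <⟨ 0<1 ⟩
      1#           ≈⟨ x*x⁻¹≈1 0<x ⟨
      x * x ⁻¹     ≈⟨ *-comm _ _ ⟩
      x ⁻¹ * x     ∎)
      where open ≤-Reasoning

    0<x/y : ∀ {x y} → 0# < x → 0# < y → 0# < x / y
    0<x/y 0<x 0<y = 0<x*y 0<x (0<x⁻¹ 0<y)

    0≤x+x⇒0≤x : ∀ {x} → 0# ≤ x + x → 0# ≤ x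
    0≤x+x⇒0≤x {x} p = *-cancelʳ-≤ (0<fromℕ 2) (≤-respˡ (sym (zeroˡ _)) (≤-respʳ
      (solve 1 (λ x → x :+ x := x :* con (+ 2)) refl x) p))

    0≤x^n : ∀ {x} n → 0# ≤ x → 0# ≤ x ^ n
    0≤x^n zero    0≤x = <⇒≤ 0<1
    0≤x^n (suc n) 0≤x = 0≤x*y 0≤x (0≤x^n n 0≤x)

    ≼-+ : ∀ {x X y Y} → x ≼ X → y ≼ Y → x + y ≼ X + Y
    ≼-+ {x} {X} {y} {Y} (p , q) (p′ , q′) = +-mono p p′ ,
      ≤-respˡ (solve 2 (λ x y → :- x :- y := :- (x :+ y)) refl x y) (+-mono q q′)

    ≼-neg : ∀ {x X} → x ≼ X → - x ≼ X
    ≼-neg {x} (p , q) = q , ≤-respˡ (solve 1 (λ x → x := :- (:- x)) refl x) p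

    -- No case split on signs: 2(XY - xy) = (X - x)(Y + y) + (X + x)(Y - y), and 2(XY + xy) = (X -
    -- x)(Y - y) + (X + x)(Y + y).
    ≼-* : ∀ {x X y Y} → x ≼ X → y ≼ Y → x * y ≼ X * Y
    ≼-* {x} {X} {y} {Y} (p , q) (p′ , q′) =
        0≤y-x⇒x≤y (0≤x+x⇒0≤x (≤-respʳ
          (solve 4 (λ x X y Y → (X :- x) :* (Y :- (:- y)) :+ (X :- (:- x)) :* (Y :- y)
                      := X :* Y :- x :* y :+ (X :* Y :- x :* y)) refl x X y Y)
          (0≤x+y (0≤x*y (x≤y⇒0≤y-x p) (x≤y⇒0≤y-x q′)) (0≤x*y (x≤y⇒0≤y-x q) (x≤y⇒0≤y-x p′)))))
      , 0≤y-x⇒x≤y (0≤x+x⇒0≤x (≤-respʳ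
          (solve 4 (λ x X y Y → (X :- x) :* (Y :- y) :+ (X :- (:- x)) :* (Y :- (:- y))
                      := X :* Y :- (:- (x :* y)) :+ (X :* Y :- (:- (x :* y)))) refl x X y Y)
          (0≤x+y (0≤x*y (x≤y⇒0≤y-x p) (x≤y⇒0≤y-x p′)) (0≤x*y (x≤y⇒0≤y-x q) (x≤y⇒0≤y-x q′)))))

    ≼-bound : ∀ x → ∃[ X ] (0# ≤ X × x ≼ X)
    ≼-bound x with ≤-total 0# x
    ... | inj₁ 0≤x = x , 0≤x , ≤-refl ,
      ≤-by (0≤x+y 0≤x 0≤x) (solve 1 (λ x → x :- (:- x) := x :+ x) refl x)
    ... | inj₂ x≤0 = - x , 0≤-x ,
      ≤-by (0≤x+y 0≤-x 0≤-x) (solve 1 (λ x → :- x :- x := :- x :+ :- x) refl x) , ≤-refl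
      where
      0≤-x : 0# ≤ - x
      0≤-x = ≤-respʳ (+-identityˡ _) (x≤y⇒0≤y-x x≤0)

-- Limits of sequences.

module Limits {c ℓ₁ ℓ₂} (R : RealNumbers c ℓ₁ ℓ₂) where
  open RealNumbers R
  open OrderedField R

  Null : (ℕ → Carrier) → Set _
  Null d = ∀ δ → 0# < δ → ∃[ n₀ ] (∀ n → n₀ ℕ.≤ n → d n ≼ δ)

  infix 4 _↝_
  _↝_ : (ℕ → Carrier) → Carrier → Set _
  a ↝ x = Null (λ n → a n - x)

  ½ : Carrier
  ½ = fromℕ 2 ⁻¹

  abstract
    0<½ : 0# < ½
    0<½ = 0<x⁻¹ (0<fromℕ 2)

    x½+x½≈x : ∀ x → x * ½ + x * ½ ≈ x
    x½+x½≈x x = trans (solve 2 (λ x h → x :* h :+ x :* h := x :* (con (+ 2) :* h)) refl x ½)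
      (trans (*-congˡ (x*x⁻¹≈1 (0<fromℕ 2))) (*-identityʳ x))

  ≼-respˡ : ∀ {x y X} → x ≈ y → x ≼ X → y ≼ X
  ≼-respˡ x≈y (p , q) = ≤-respˡ x≈y p , ≤-respˡ (-‿cong x≈y) q

  ≼-respʳ : ∀ {x X Y} → X ≈ Y → x ≼ X → x ≼ Y
  ≼-respʳ X≈Y (p , q) = ≤-respʳ X≈Y p , ≤-respʳ X≈Y q

  null-cong : ∀ {d e} → (∀ n → d n ≈ e n) → Null d → Null e
  null-cong d≈e dnull δ 0<δ with dnull δ 0<δ
  ... | n₀ , bound = n₀ , λ n n₀≤n → ≼-respˡ (d≈e n) (bound n n₀≤n)

  null-+ : ∀ {d e} → Null d → Null e → Null (λ n → d n + e n)
  null-+ dnull enull δ 0<δ with dnull (δ * ½) (0<x*y 0<δ 0<½) | enull (δ * ½) (0<x*y 0<δ 0<½)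
  ... | m , p | n , q = m ℕ.⊔ n , λ k m⊔n≤k → ≼-respʳ (x½+x½≈x δ)
    (≼-+ (p k (ℕₚ.≤-trans (ℕₚ.m≤m⊔n m n) m⊔n≤k)) (q k (ℕₚ.≤-trans (ℕₚ.m≤n⊔m m n) m⊔n≤k)))

  null-neg : ∀ {d} → Null d → Null (λ n → - d n)
  null-neg dnull δ 0<δ with dnull δ 0<δ
  ... | n₀ , bound = n₀ , λ n n₀≤n → ≼-neg (bound n n₀≤n)

  null-* : ∀ {d e} → Null d → Null e → Null (λ n → d n * e n)
  null-* dnull enull δ 0<δ with dnull δ 0<δ | enull 1# 0<1
  ... | m , p | n , q = m ℕ.⊔ n , λ k m⊔n≤k → ≼-respʳ (*-identityʳ δ)
    (≼-* (p k (ℕₚ.≤-trans (ℕₚ.m≤m⊔n m n) m⊔n≤k)) (q k (ℕₚ.≤-trans (ℕₚ.m≤n⊔m m n) m⊔n≤k)))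

  null-scale : ∀ {d} x → Null d → Null (λ n → x * d n)
  null-scale x dnull δ 0<δ with ≼-bound x
  ... | X , 0≤X , p , q with dnull (δ / (1# + X)) (0<x/y 0<δ (0<x+y 0<1 0≤X))
  ...   | n₀ , bound = n₀ , λ n n₀≤n → ≼-respʳ (trans (*-comm _ _) (x/y*y≈x (0<x+y 0<1 0≤X)))
    (≼-* (≤-trans p X≤1+X , ≤-trans q X≤1+X) (bound n n₀≤n))
    where
    X≤1+X : X ≤ 1# + X
    X≤1+X = ≤-by (<⇒≤ 0<1) (solve 1 (λ x → con (+ 1) :+ x :- x := con (+ 1)) refl X)

  null-limit-nonneg : ∀ {d x} m → Null d → (∀ n → m ℕ.≤ n → 0# ≤ x + d n) → 0# ≤ x
  null-limit-nonneg {d} {x} m dnull nonneg with 0# ≤? x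
  ... | yes 0≤x = 0≤x
  -- With tolerance -x/2 the sum x + d k is eventually at most x/2, so 0 ≤ x/2, against x < 0.
  ... | no  0≰x with dnull (- x * ½) (0<x*y 0<-x 0<½)
    where
    0<-x : 0# < - x
    0<-x = <-by (x<y⇒0<y-x (≰⇒> 0≰x)) (solve 1 (λ x → :- x :- con (+ 0) := con (+ 0) :- x) refl x)
  ...   | n₀ , bound = ⊥-elim (0≰x (≤-respʳ (x½+x½≈x x) (0≤x+y 0≤x½ 0≤x½)))
    where
    k = m ℕ.⊔ n₀
    0≤x½ : 0# ≤ x * ½
    0≤x½ = begin
      0#                    ≤⟨ nonneg k (ℕₚ.m≤m⊔n m n₀) ⟩
      x + d k               ≤⟨ +-mono (≤-reflexive (sym (x½+x½≈x x))) (proj₁ (bound k (ℕₚ.m≤n⊔m m n₀))) ⟩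
      x * ½ + x * ½ + - x * ½   ≈⟨ solve 2 (λ x h → x :* h :+ x :* h :+ :- x :* h := x :* h) refl x ½ ⟩
      x * ½                 ∎
      where open ≤-Reasoning

  ⟶⇒↝ : ∀ {a x} → a ⟶ x → a ↝ x
  ⟶⇒↝ {a} {x} a⟶x δ 0<δ with a⟶x δ 0<δ
  ... | n₀ , bound = n₀ , λ n n₀≤n → <⇒≤ (proj₁ (bound n n₀≤n)) ,
    ≤-respˡ (solve 2 (λ a x → x :- a := :- (a :- x)) refl (a n) x) (<⇒≤ (proj₂ (bound n n₀≤n)))

  ↝-const : ∀ x → (λ _ → x) ↝ x
  ↝-const x δ 0<δ = 0 , λ _ _ → ≼-respˡ (sym (-‿inverseʳ x))
    (<⇒≤ 0<δ , ≤-respˡ (solve 0 (con (+ 0) := :- con (+ 0)) refl) (<⇒≤ 0<δ))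

  ↝-double : ∀ {a x} → a ↝ x → (λ n → a (n ℕ.+ n)) ↝ x
  ↝-double a↝x δ 0<δ with a↝x δ 0<δ
  ... | n₀ , bound = n₀ , λ n n₀≤n → bound (n ℕ.+ n) (ℕₚ.≤-trans n₀≤n (ℕₚ.m≤m+n n n))

  ↝-+ : ∀ {a b x y} → a ↝ x → b ↝ y → (λ n → a n + b n) ↝ x + y
  ↝-+ {a} {b} {x} {y} a↝x b↝y = null-cong
    (λ n → solve 4 (λ a b x y → a :- x :+ (b :- y) := a :+ b :- (x :+ y)) refl (a n) (b n) x y)
    (null-+ a↝x b↝y)

  ↝-neg : ∀ {a x} → a ↝ x → (λ n → - a n) ↝ - x
  ↝-neg {a} {x} a↝x = null-cong
    (λ n → solve 2 (λ a x → :- (a :- x) := :- a :- (:- x)) refl (a n) x) (null-neg a↝x)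

  -- The error is split as (a - x)(b - y) + y(a - x) + x(b - y), so boundedness of convergent
  -- sequences is never invoked.
  ↝-* : ∀ {a b x y} → a ↝ x → b ↝ y → (λ n → a n * b n) ↝ x * y
  ↝-* {a} {b} {x} {y} a↝x b↝y = null-cong
    (λ n → solve 4 (λ a b x y → (a :- x) :* (b :- y) :+ (y :* (a :- x) :+ x :* (b :- y))
                             := a :* b :- x :* y) refl (a n) (b n) x y)
    (null-+ (null-* a↝x b↝y) (null-+ (null-scale y a↝x) (null-scale x b↝y)))

  ↝-mono : ∀ {a b x y} m → a ↝ x → b ↝ y → (∀ n → m ℕ.≤ n → a n ≤ b n) → x ≤ y
  ↝-mono {a} {b} {x} {y} m a↝x b↝y a≤b = 0≤y-x⇒x≤y (null-limit-nonneg m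
    (null-+ b↝y (null-neg a↝x))
    λ n m≤n → ≤-respʳ
      (solve 4 (λ a b x y → b :- a := y :- x :+ (b :- y :- (a :- x))) refl (a n) (b n) x y)
      (x≤y⇒0≤y-x (a≤b n m≤n)))

-- Partial sums and Cauchy products.

module PartialSums {c ℓ₁ ℓ₂} (R : RealNumbers c ℓ₁ ℓ₂) where
  open RealNumbers R
  open OrderedField R
  open Algebra.Properties.Semiring.Sum semiring using (sum-cong-≋)

  Seq : Set c
  Seq = ℕ → Carrier

  Σ< : Seq → ℕ → Carrier
  Σ< f n = ∑[ k < n ] f (toℕ k)

  Σ<-cong : ∀ {f g} → (∀ k → f k ≈ g k) → ∀ n → Σ< f n ≈ Σ< g n
  Σ<-cong f≈g n = sum-cong-≋ {n} (λ k → f≈g (toℕ k))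

  Σ<-cong-< : ∀ {f g} n → (∀ k → k ℕ.< n → f k ≈ g k) → Σ< f n ≈ Σ< g n
  Σ<-cong-< zero    f≈g = refl
  Σ<-cong-< (suc n) f≈g = +-cong (f≈g 0 ℕ.z<s) (Σ<-cong-< n (λ k k<n → f≈g (suc k) (ℕ.s<s k<n)))

  Σ<-suc : ∀ f n → Σ< f (suc n) ≈ Σ< f n + f n
  Σ<-suc f zero    = +-comm _ _
  Σ<-suc f (suc n) = trans (+-congˡ (Σ<-suc (f ∘ suc) n)) (sym (+-assoc _ _ _))

  Σ<-0≤ : ∀ {f} n → (∀ k → k ℕ.< n → 0# ≤ f k) → 0# ≤ Σ< f n
  Σ<-0≤ zero    0≤f = ≤-refl
  Σ<-0≤ (suc n) 0≤f = 0≤x+y (0≤f 0 ℕ.z<s) (Σ<-0≤ n (λ k k<n → 0≤f (suc k) (ℕ.s<s k<n)))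

  Σ<-mono : ∀ {f g} n → (∀ k → k ℕ.< n → f k ≤ g k) → Σ< f n ≤ Σ< g n
  Σ<-mono zero    f≤g = ≤-refl
  Σ<-mono (suc n) f≤g = +-mono (f≤g 0 ℕ.z<s) (Σ<-mono n (λ k k<n → f≤g (suc k) (ℕ.s<s k<n)))

  Σ<-≤-const : ∀ {f x} n → (∀ k → k ℕ.< n → f k ≤ x) → Σ< f n ≤ fromℕ n * x
  Σ<-≤-const {x = x} zero    f≤x = ≤-reflexive (sym (zeroˡ x))
  Σ<-≤-const {x = x} (suc n) f≤x = ≤-respʳ
    (solve 2 (λ x n → x :+ n :* x := (con (+ 1) :+ n) :* x) refl x (fromℕ n))
    (+-mono (f≤x 0 ℕ.z<s) (Σ<-≤-const n (λ k k<n → f≤x (suc k) (ℕ.s<s k<n))))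

  Σ<-+ : ∀ f m n → Σ< f (m ℕ.+ n) ≈ Σ< f m + Σ< (λ k → f (m ℕ.+ k)) n
  Σ<-+ f zero    n = sym (+-identityˡ _)
  Σ<-+ f (suc m) n = trans (+-congˡ (Σ<-+ (f ∘ suc) m n)) (sym (+-assoc _ _ _))

  Σ<-extend : ∀ {f m n} → m ℕ.≤ n → (∀ k → k ℕ.< n → 0# ≤ f k) → Σ< f m ≤ Σ< f n
  Σ<-extend {n = n} ℕ.z≤n 0≤f       = Σ<-0≤ n 0≤f
  Σ<-extend (ℕ.s≤s m≤n)   0≤f = +-mono ≤-refl (Σ<-extend m≤n (λ k k<n → 0≤f (suc k) (ℕ.s<s k<n)))

  -- The Cauchy product, with n-th entry the sum of f j * g (n - j). Recursion that drops the head
  -- of `f` avoids subtraction of indices.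
  conv : Seq → Seq → Seq
  conv f g zero    = f 0 * g 0
  conv f g (suc n) = f 0 * g (suc n) + conv (f ∘ suc) g n

  conv-cong : ∀ {f f′ g g′} → (∀ k → f k ≈ f′ k) → (∀ k → g k ≈ g′ k) →
              ∀ n → conv f g n ≈ conv f′ g′ n
  conv-cong f≈f′ g≈g′ zero    = *-cong (f≈f′ 0) (g≈g′ 0)
  conv-cong f≈f′ g≈g′ (suc n) =
    +-cong (*-cong (f≈f′ 0) (g≈g′ (suc n))) (conv-cong (f≈f′ ∘ suc) g≈g′ n)

  conv-scaleˡ : ∀ x f g n → conv (λ k → x * f k) g n ≈ x * conv f g n
  conv-scaleˡ x f g zero    = *-assoc _ _ _
  conv-scaleˡ x f g (suc n) =
    trans (+-cong (*-assoc _ _ _) (conv-scaleˡ x (f ∘ suc) g n)) (sym (distribˡ _ _ _))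

  conv-scaleʳ : ∀ x f g n → conv f (λ k → x * g k) n ≈ x * conv f g n
  conv-scaleʳ x f g zero    = solve 3 (λ x f g → f :* (x :* g) := x :* (f :* g)) refl x (f 0) (g 0)
  conv-scaleʳ x f g (suc n) = trans (+-congˡ (conv-scaleʳ x (f ∘ suc) g n))
    (solve 4 (λ x f g c → f :* (x :* g) :+ x :* c := x :* (f :* g :+ c)) refl
       x (f 0) (g (suc n)) (conv (f ∘ suc) g n))

  conv-+ˡ : ∀ f f′ g n → conv (λ k → f k + f′ k) g n ≈ conv f g n + conv f′ g n
  conv-+ˡ f f′ g zero    = distribʳ _ _ _
  conv-+ˡ f f′ g (suc n) = trans (+-congˡ (conv-+ˡ (f ∘ suc) (f′ ∘ suc) g n))
    (solve 5 (λ f f′ g c c′ → (f :+ f′) :* g :+ (c :+ c′) := f :* g :+ c :+ (f′ :* g :+ c′)) refl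
       (f 0) (f′ 0) (g (suc n)) (conv (f ∘ suc) g n) (conv (f′ ∘ suc) g n))

  -- The coefficients of the derivative of the power series ∑ₖ f k Xᵏ.
  D : Seq → Seq
  D f k = fromℕ (suc k) * f (suc k)

  -- The Leibniz rule: the weight n + 1 of a product f j * g (n + 1 - j) splits as j + (n + 1 - j).
  -- In the recursion the spare copy of `c₁` raises the weights in `D (f ∘ suc)` by one, to those in
  -- `D f ∘ suc`.
  conv-D : ∀ f g n → D (conv f g) n ≈ conv (D f) g n + conv f (D g) n
  conv-D f g zero    =
    solve 5 (λ a b c d e → e :* (a :* d :+ c :* b) := e :* c :* b :+ a :* (e :* d)) refl
      (f 0) (g 0) (f 1) (g 1) (fromℕ 1)
  conv-D f g (suc n) = begin
    (1# + k) * (f 0 * g (suc (suc n)) + c₁)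
      ≈⟨ solve 4 (λ k f g c → (con (+ 1) :+ k) :* (f :* g :+ c)
                   := f :* ((con (+ 1) :+ k) :* g) :+ (c :+ k :* c)) refl k (f 0) (g (suc (suc n))) c₁ ⟩
    h + (c₁ + k * c₁)
      ≈⟨ +-congˡ (+-congˡ (conv-D (f ∘ suc) g n)) ⟩
    h + (f 1 * g (suc n) + c₂ + (conv (D (f ∘ suc)) g n + c₃))
      ≈⟨ solve 5 (λ h a c₂ c₁ c₃ → h :+ (a :+ c₂ :+ (c₁ :+ c₃)) := a :+ (c₂ :+ c₁) :+ (h :+ c₃)) refl
           h (f 1 * g (suc n)) c₂ (conv (D (f ∘ suc)) g n) c₃ ⟩
    f 1 * g (suc n) + (c₂ + conv (D (f ∘ suc)) g n) + (h + c₃)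
      ≈⟨ +-congʳ (+-cong (*-congʳ (solve 1 (λ x → x := (con (+ 1) :+ con (+ 0)) :* x) refl (f 1)))
           (sym (conv-+ˡ (λ k → f (suc (suc k))) (D (f ∘ suc)) g n))) ⟩
    D f 0 * g (suc n) + conv (λ k → f (suc (suc k)) + D (f ∘ suc) k) g n + (h + c₃)
      ≈⟨ +-congʳ (+-congˡ (conv-cong
           (λ k → solve 2 (λ x k → x :+ k :* x := (con (+ 1) :+ k) :* x) refl (f (suc (suc k))) (fromℕ (suc k)))
           (λ _ → refl) n)) ⟩
    D f 0 * g (suc n) + conv (D f ∘ suc) g n + (h + c₃) ∎
    where
    open ≈-Reasoning
    k  = fromℕ (suc n)
    c₁ = conv (f ∘ suc) g (suc n)
    c₂ = conv (λ k → f (suc (suc k))) g n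
    c₃ = conv (f ∘ suc) (D g) n
    h  = f 0 * D g (suc n)

  -- The left side runs over the triangle of index pairs with j + k ≤ n; the row j = 0 is split off.
  Σ<-conv-suc : ∀ f g n → Σ< (conv f g) (suc n) ≈ f 0 * Σ< g (suc n) + Σ< (conv (f ∘ suc) g) n
  Σ<-conv-suc f g zero    = solve 2 (λ f g → f :* g :+ con (+ 0) := f :* (g :+ con (+ 0)) :+ con (+ 0)) refl (f 0) (g 0)
  Σ<-conv-suc f g (suc n) = begin
    Σ< (conv f g) (suc (suc n))
      ≈⟨ Σ<-suc (conv f g) (suc n) ⟩
    Σ< (conv f g) (suc n) + (f 0 * g (suc n) + conv (f ∘ suc) g n)
      ≈⟨ +-congʳ (Σ<-conv-suc f g n) ⟩
    f 0 * Σ< g (suc n) + Σ< (conv (f ∘ suc) g) n + (f 0 * g (suc n) + conv (f ∘ suc) g n)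
      ≈⟨ solve 5 (λ f s c g d → f :* s :+ c :+ (f :* g :+ d) := f :* (s :+ g) :+ (c :+ d)) refl
           (f 0) (Σ< g (suc n)) (Σ< (conv (f ∘ suc) g) n) (g (suc n)) (conv (f ∘ suc) g n) ⟩
    f 0 * (Σ< g (suc n) + g (suc n)) + (Σ< (conv (f ∘ suc) g) n + conv (f ∘ suc) g n)
      ≈⟨ +-cong (*-congˡ (Σ<-suc g (suc n))) (Σ<-suc (conv (f ∘ suc) g) n) ⟨
    f 0 * Σ< g (suc (suc n)) + Σ< (conv (f ∘ suc) g) (suc n) ∎
    where open ≈-Reasoning

  ≼-Σ< : ∀ {f F} n → (∀ k → f k ≼ F k) → Σ< f n ≼ Σ< F n
  ≼-Σ< zero    f≼F = ≤-refl , ≤-reflexive (solve 0 (:- con (+ 0) := con (+ 0)) refl)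
  ≼-Σ< (suc n) f≼F = ≼-+ (f≼F 0) (≼-Σ< n (f≼F ∘ suc))

  -- For n ≤ m this is the sum of f j * g k over the pairs in the n by m rectangle that lie outside
  -- the triangle j + k < n. As a sum of products it is monotone under `≼`, which is `≼-excess`. The
  -- two sides are separate because removing a row lowers n but keeps m.
  excess : Seq → Seq → ℕ → ℕ → Carrier
  excess f g n m = Σ< f n * Σ< g m - Σ< (conv f g) n

  excess-suc : ∀ f g n k → excess f g (suc n) (suc n ℕ.+ k) ≈
    f 0 * Σ< (λ j → g (suc n ℕ.+ j)) k + excess (f ∘ suc) g n (suc n ℕ.+ k)
  excess-suc f g n k = begin
    (f 0 + s) * Σ< g (suc n ℕ.+ k) - Σ< (conv f g) (suc n)
      ≈⟨ +-cong (distribʳ _ _ _) (-‿cong (Σ<-conv-suc f g n)) ⟩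
    f 0 * Σ< g (suc n ℕ.+ k) + s * Σ< g (suc n ℕ.+ k) - (f 0 * Σ< g (suc n) + d)
      ≈⟨ +-congʳ (+-congʳ (*-congˡ (Σ<-+ g (suc n) k))) ⟩
    f 0 * (Σ< g (suc n) + t) + s * Σ< g (suc n ℕ.+ k) - (f 0 * Σ< g (suc n) + d)
      ≈⟨ solve 5 (λ f G t p c → f :* (G :+ t) :+ p :- (f :* G :+ c) := f :* t :+ (p :- c)) refl
           (f 0) (Σ< g (suc n)) t (s * Σ< g (suc n ℕ.+ k)) d ⟩
    f 0 * t + (s * Σ< g (suc n ℕ.+ k) - d) ∎
    where
    open ≈-Reasoning
    s = Σ< (f ∘ suc) n
    t = Σ< (λ j → g (suc n ℕ.+ j)) k
    d = Σ< (conv (f ∘ suc) g) n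

  ≼-excess : ∀ {f F g G} → (∀ k → f k ≼ F k) → (∀ k → g k ≼ G k) →
             ∀ n m → n ℕ.≤ m → excess f g n m ≼ excess F G n m
  ≼-excess {f} {F} {g} {G} f≼F g≼G zero m _ =
      ≤-reflexive (trans (zero-excess f g) (sym (zero-excess F G)))
    , ≤-reflexive (trans (-‿cong (zero-excess f g))
        (trans (solve 0 (:- con (+ 0) := con (+ 0)) refl) (sym (zero-excess F G))))
    where
    zero-excess : ∀ f g → excess f g 0 m ≈ 0#
    zero-excess f g = solve 1 (λ x → con (+ 0) :* x :- con (+ 0) := con (+ 0)) refl (Σ< g m)
  ≼-excess {f} {F} {g} {G} f≼F g≼G (suc n) m n<m with ℕₚ.m≤n⇒∃[o]m+o≡n n<m
  ... | k , ≡.refl = proj₁ step , proj₂ step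
    where
    sum≼ : f 0 * Σ< (λ j → g (suc n ℕ.+ j)) k + excess (f ∘ suc) g n m ≼
           F 0 * Σ< (λ j → G (suc n ℕ.+ j)) k + excess (F ∘ suc) G n m
    sum≼ = ≼-+ (≼-* (f≼F 0) (≼-Σ< k (λ j → g≼G (suc n ℕ.+ j))))
               (≼-excess (f≼F ∘ suc) g≼G n m (ℕₚ.<⇒≤ n<m))
    step : excess f g (suc n) m ≼ excess F G (suc n) m
    step = ≤-respˡ (sym (excess-suc f g n k)) (≤-respʳ (sym (excess-suc F G n k)) (proj₁ sum≼))
         , ≤-respˡ (-‿cong (sym (excess-suc f g n k))) (≤-respʳ (sym (excess-suc F G n k)) (proj₂ sum≼))

  -- The n by m rectangle lies inside the triangle j + k < n + m, and all terms are nonnegative.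
  Σ<*Σ<≤Σ<conv : ∀ {f g} → (∀ k → 0# ≤ f k) → (∀ k → 0# ≤ g k) →
                 ∀ n m → Σ< f n * Σ< g m ≤ Σ< (conv f g) (n ℕ.+ m)
  Σ<*Σ<≤Σ<conv {f} {g} 0≤f 0≤g zero m = ≤-respˡ (sym (zeroˡ _)) (Σ<-0≤ m (λ k _ → conv-0≤ f 0≤f k))
    where
    conv-0≤ : ∀ f → (∀ k → 0# ≤ f k) → ∀ k → 0# ≤ conv f g k
    conv-0≤ f 0≤f zero    = 0≤x*y (0≤f 0) (0≤g 0)
    conv-0≤ f 0≤f (suc k) = 0≤x+y (0≤x*y (0≤f 0) (0≤g (suc k))) (conv-0≤ (f ∘ suc) (0≤f ∘ suc) k)
  Σ<*Σ<≤Σ<conv {f} {g} 0≤f 0≤g (suc n) m = begin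
    (f 0 + Σ< (f ∘ suc) n) * Σ< g m
      ≈⟨ distribʳ _ _ _ ⟩
    f 0 * Σ< g m + Σ< (f ∘ suc) n * Σ< g m
      ≤⟨ +-mono (*-monoˡ (0≤f 0) (Σ<-extend (ℕₚ.m≤n+m m (suc n)) (λ k _ → 0≤g k)))
                (Σ<*Σ<≤Σ<conv (0≤f ∘ suc) 0≤g n m) ⟩
    f 0 * Σ< g (suc n ℕ.+ m) + Σ< (conv (f ∘ suc) g) (n ℕ.+ m)
      ≈⟨ Σ<-conv-suc f g (n ℕ.+ m) ⟨
    Σ< (conv f g) (suc n ℕ.+ m) ∎
    where open ≤-Reasoning

-- The exponential function and its tangent inequalities.

module Exponential {c ℓ₁ ℓ₂} (R : RealNumbers c ℓ₁ ℓ₂) (E : ExpLog R) where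
  open RealNumbers R
  open ExpLog E
  open OrderedField R
  open Limits R
  open PartialSums R
  open Algebra.Properties.Semiring.Mult semiring using (×1-homo-*)
  open Algebra.Properties.Semiring.Exp semiring using (^-congˡ)

  term : Carrier → Seq
  term x k = x ^ k / fromℕ (k !)

  abstract
    0<fromℕ[n!] : ∀ n → 0# < fromℕ (n !)
    0<fromℕ[n!] n = 0<fromℕ (n !) {{n ℕₚ.!≢0}}

    term-0 : ∀ x → term x 0 ≈ 1#
    term-0 x = trans (*-congʳ (sym (+-identityʳ 1#))) (x*x⁻¹≈1 (0<fromℕ 1))

    term-cong : ∀ {x y} → x ≈ y → ∀ k → term x k ≈ term y k
    term-cong x≈y k = *-congʳ (^-congˡ k x≈y)

    term-D : ∀ x k → D (term x) k ≈ x * term x k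
    term-D x k = *-cancelʳ-≈ (0<fromℕ[n!] k) (begin
      fromℕ (suc k) * term x (suc k) * fromℕ (k !)
        ≈⟨ solve 3 (λ a b c → a :* b :* c := b :* (a :* c)) refl (fromℕ (suc k)) (term x (suc k)) (fromℕ (k !)) ⟩
      term x (suc k) * (fromℕ (suc k) * fromℕ (k !))
        ≈⟨ *-congˡ (×1-homo-* (suc k) (k !)) ⟨
      term x (suc k) * fromℕ (suc k !)
        ≈⟨ x/y*y≈x (0<fromℕ[n!] (suc k)) ⟩
      x * x ^ k
        ≈⟨ *-congˡ (x/y*y≈x (0<fromℕ[n!] k)) ⟨
      x * (term x k * fromℕ (k !))
        ≈⟨ *-assoc _ _ _ ⟨
      x * term x k * fromℕ (k !) ∎)
      where open ≈-Reasoning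

    -- Both sides have constant coefficient 1 and are multiplied by x + y under D.
    conv-term : ∀ x y k → conv (term x) (term y) k ≈ term (x + y) k
    conv-term x y zero = trans (*-cong (term-0 x) (term-0 y)) (trans (*-identityˡ 1#) (sym (term-0 (x + y))))
    conv-term x y (suc k) = *-cancelʳ-≈ (0<fromℕ (suc k)) (begin
      conv (term x) (term y) (suc k) * fromℕ (suc k)
        ≈⟨ *-comm _ _ ⟩
      D (conv (term x) (term y)) k
        ≈⟨ conv-D (term x) (term y) k ⟩
      conv (D (term x)) (term y) k + conv (term x) (D (term y)) k
        ≈⟨ +-cong (conv-cong (term-D x) (λ _ → refl) k) (conv-cong (λ _ → refl) (term-D y) k) ⟩
      conv (λ j → x * term x j) (term y) k + conv (term x) (λ j → y * term y j) k
        ≈⟨ +-cong (conv-scaleˡ x (term x) (term y) k) (conv-scaleʳ y (term x) (term y) k) ⟩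
      x * conv (term x) (term y) k + y * conv (term x) (term y) k
        ≈⟨ distribʳ _ _ _ ⟨
      (x + y) * conv (term x) (term y) k
        ≈⟨ *-congˡ (conv-term x y k) ⟩
      (x + y) * term (x + y) k
        ≈⟨ term-D (x + y) k ⟨
      D (term (x + y)) k
        ≈⟨ *-comm _ _ ⟩
      term (x + y) (suc k) * fromℕ (suc k) ∎)
      where open ≈-Reasoning

    0≤fromℕ[n!]⁻¹ : ∀ n → 0# ≤ fromℕ (n !) ⁻¹
    0≤fromℕ[n!]⁻¹ n = <⇒≤ (0<x⁻¹ (0<fromℕ[n!] n))

    0≤term : ∀ {x} → 0# ≤ x → ∀ k → 0# ≤ term x k
    0≤term 0≤x k = 0≤x*y (0≤x^n k 0≤x) (0≤fromℕ[n!]⁻¹ k)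

    0≤x⇒x≼x : ∀ {x} → 0# ≤ x → x ≼ x
    0≤x⇒x≼x {x} 0≤x = ≤-refl , ≤-by (0≤x+y 0≤x 0≤x) (solve 1 (λ x → x :- (:- x) := x :+ x) refl x)

    ≼-^ : ∀ {x X} → x ≼ X → ∀ n → x ^ n ≼ X ^ n
    ≼-^ x≼X zero    = 0≤x⇒x≼x (<⇒≤ 0<1)
    ≼-^ x≼X (suc n) = ≼-* x≼X (≼-^ x≼X n)

    ≼-term : ∀ {x X} → x ≼ X → ∀ k → term x k ≼ term X k
    ≼-term x≼X k = ≼-* (≼-^ x≼X k) (0≤x⇒x≼x (0≤fromℕ[n!]⁻¹ k))

    exp-limit : ∀ x → Σ< (term x) ↝ exp x
    exp-limit x = ⟶⇒↝ (exp-series x)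

    exp-cong : ∀ {x y} → x ≈ y → exp x ≈ exp y
    exp-cong {x} {y} x≈y = antisym
      (↝-mono 0 (exp-limit x) (exp-limit y) (λ n _ → ≤-reflexive (Σ<-cong (term-cong x≈y) n)))
      (↝-mono 0 (exp-limit y) (exp-limit x) (λ n _ → ≤-reflexive (Σ<-cong (term-cong (sym x≈y)) n)))

    excess-limit : ∀ x y → (λ n → excess (term x) (term y) n n) ↝ exp x * exp y - exp (x + y)
    excess-limit x y = null-cong
      (λ n → +-congʳ (+-congˡ (-‿cong (Σ<-cong (λ k → sym (conv-term x y k)) n))))
      (↝-+ (↝-* (exp-limit x) (exp-limit y)) (↝-neg (exp-limit (x + y))))

    -- The n by n square of products fits into the triangle of side 2n, and the partial sums of
    -- length 2n still tend to exp (x + y).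
    exp-+-nonneg : ∀ {x y} → 0# ≤ x → 0# ≤ y → exp x * exp y - exp (x + y) ≤ 0#
    exp-+-nonneg {x} {y} 0≤x 0≤y = ≤-by
      (x≤y⇒0≤y-x (↝-mono 0 (↝-* (exp-limit x) (exp-limit y)) (↝-double (exp-limit (x + y)))
        λ n _ → ≤-respʳ (Σ<-cong (conv-term x y) (n ℕ.+ n))
          (Σ<*Σ<≤Σ<conv (0≤term 0≤x) (0≤term 0≤y) n n)))
      (solve 2 (λ p q → con (+ 0) :- (p :- q) := q :- p) refl (exp x * exp y) (exp (x + y)))

    -- The truncation error for x, y is dominated by the one for ∣x∣, ∣y∣, where
    -- all terms have the same sign.
    exp-+ : ∀ x y → exp (x + y) ≈ exp x * exp y
    exp-+ x y with ≼-bound x | ≼-bound y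
    ... | X , 0≤X , x≼X | Y , 0≤Y , y≼Y = antisym
      (≤-by (x≤y⇒0≤y-x (≤-trans
          (↝-mono 0 (↝-neg (excess-limit x y)) (excess-limit X Y) (λ n _ → proj₂ (bound n)))
          (exp-+-nonneg 0≤X 0≤Y)))
        (solve 2 (λ p q → p :- q := con (+ 0) :- (:- (p :- q))) refl (exp x * exp y) (exp (x + y))))
      (≤-by (x≤y⇒0≤y-x (≤-trans
          (↝-mono 0 (excess-limit x y) (excess-limit X Y) (λ n _ → proj₁ (bound n)))
          (exp-+-nonneg 0≤X 0≤Y)))
        (solve 2 (λ p q → q :- p := con (+ 0) :- (p :- q)) refl (exp x * exp y) (exp (x + y))))
      where
      bound : ∀ n → excess (term x) (term y) n n ≼ excess (term X) (term Y) n n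
      bound n = ≼-excess (≼-term x≼X) (≼-term y≼Y) n n ℕₚ.≤-refl

    1+x≤exp-nonneg : ∀ {x} → 0# ≤ x → 1# + x ≤ exp x
    1+x≤exp-nonneg {x} 0≤x = ↝-mono 2 (↝-const (1# + x)) (exp-limit x) bound
      where
      open ≤-Reasoning
      bound : ∀ n → 2 ℕ.≤ n → 1# + x ≤ Σ< (term x) n
      bound (suc (suc n)) _ = begin
        1# + x
          ≈⟨ +-cong (term-0 x) (trans (term-D x 0) (trans (*-congˡ (term-0 x)) (*-identityʳ x))) ⟨
        term x 0 + fromℕ 1 * term x 1
          ≈⟨ +-congˡ (solve 1 (λ t → (con (+ 1) :+ con (+ 0)) :* t := t) refl (term x 1)) ⟩
        term x 0 + term x 1
          ≤⟨ +-mono ≤-refl (≤-by (Σ<-0≤ n (λ k _ → 0≤term 0≤x (suc (suc k))))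
               (solve 2 (λ t s → t :+ s :- t := s) refl (term x 1) (Σ< (λ k → term x (suc (suc k))) n))) ⟩
        Σ< (term x) (suc (suc n)) ∎
      bound 1 (ℕ.s≤s ())

    -- Termwise, x^(k+1)/(k+1)! ≤ x · x^k/k!. Divided by `exp x` this reads 1 - x ≤ exp (- x), which
    -- is how `1+x≤exp` reaches negative arguments.
    exp≤1+x*exp : ∀ {x} → 0# ≤ x → exp x ≤ 1# + x * exp x
    exp≤1+x*exp {x} 0≤x = ↝-mono 0 (exp-limit x) (↝-+ (↝-const 1#) (↝-* (↝-const x) (exp-limit x)))
      λ n _ → begin
        Σ< (term x) n
          ≤⟨ Σ<-extend (ℕₚ.n≤1+n n) (λ k _ → 0≤term 0≤x k) ⟩
        term x 0 + Σ< (term x ∘ suc) n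
          ≤⟨ +-mono (≤-reflexive (term-0 x)) (Σ<-mono n (λ k _ → decay k)) ⟩
        1# + Σ< (λ k → x * term x k) n
          ≈⟨ +-congˡ (*-distribˡ-sum {n} x (λ k → term x (toℕ k))) ⟨
        1# + x * Σ< (term x) n ∎
      where
      open ≤-Reasoning
      open Algebra.Properties.Semiring.Sum semiring using (*-distribˡ-sum)
      decay : ∀ k → term x (suc k) ≤ x * term x k
      decay k = ≤-respʳ (term-D x k) (≤-by (0≤x*y (0≤fromℕ k) (0≤term 0≤x (suc k)))
        (solve 2 (λ n t → (con (+ 1) :+ n) :* t :- t := n :* t) refl (fromℕ k) (term x (suc k))))

    exp-0 : exp 0# ≈ 1#
    exp-0 = antisym
      (≤-respʳ (solve 1 (λ e → con (+ 1) :+ con (+ 0) :* e := con (+ 1)) refl (exp 0#)) (exp≤1+x*exp ≤-refl))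
      (≤-respˡ (+-identityʳ 1#) (1+x≤exp-nonneg ≤-refl))

    exp-neg : ∀ x → exp x * exp (- x) ≈ 1#
    exp-neg x = trans (sym (exp-+ x (- x))) (trans (exp-cong (-‿inverseʳ x)) exp-0)

    0≤-x : ∀ {x} → x ≤ 0# → 0# ≤ - x
    0≤-x {x} x≤0 = ≤-respʳ (+-identityˡ _) (x≤y⇒0≤y-x x≤0)

    0<exp : ∀ x → 0# < exp x
    0<exp x with ≤-total 0# x
    ... | inj₁ 0≤x = <-≤-trans (0<x+y 0<1 0≤x) (1+x≤exp-nonneg 0≤x)
    ... | inj₂ x≤0 = *-cancelʳ-< (<⇒≤ 0<exp-x) (begin-strict
      0# * exp (- x)      ≈⟨ zeroˡ _ ⟩
      0#                  <⟨ 0<1 ⟩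
      1#                  ≈⟨ exp-neg x ⟨
      exp x * exp (- x)   ∎)
      where
      open ≤-Reasoning
      0<exp-x : 0# < exp (- x)
      0<exp-x = <-≤-trans (0<x+y 0<1 (0≤-x x≤0)) (1+x≤exp-nonneg (0≤-x x≤0))

    1+x≤exp : ∀ x → 1# + x ≤ exp x
    1+x≤exp x with ≤-total 0# x
    ... | inj₁ 0≤x = 1+x≤exp-nonneg 0≤x
    ... | inj₂ x≤0 = *-cancelʳ-≤ (0<exp (- x)) (≤-respʳ (sym (exp-neg x))
      (≤-by (x≤y⇒0≤y-x (exp≤1+x*exp (0≤-x x≤0)))
        (solve 2 (λ x e → con (+ 1) :- (con (+ 1) :+ x) :* e := con (+ 1) :+ :- x :* e :- e) refl x (exp (- x)))))

    -- Convexity of `exp` in the form used from here on: monotonicity, the entropy inequality and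
    -- the comparison of the update factors all come from a suitable choice of x and y.
    exp-tangent : ∀ x y → exp x * (1# + (y - x)) ≤ exp y
    exp-tangent x y = begin
      exp x * (1# + (y - x))   ≤⟨ *-monoˡ (<⇒≤ (0<exp x)) (1+x≤exp (y - x)) ⟩
      exp x * exp (y - x)      ≈⟨ exp-+ x (y - x) ⟨
      exp (x + (y - x))        ≈⟨ exp-cong (solve 2 (λ x y → x :+ (y :- x) := y) refl x y) ⟩
      exp y                    ∎
      where open ≤-Reasoning

    exp-mono : ∀ {x y} → x ≤ y → exp x ≤ exp y
    exp-mono {x} {y} x≤y = ≤-trans
      (≤-by (0≤x*y (<⇒≤ (0<exp x)) (x≤y⇒0≤y-x x≤y))
        (solve 2 (λ e d → e :* (con (+ 1) :+ d) :- e := e :* d) refl (exp x) (y - x)))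
      (exp-tangent x y)

    exp-mono-< : ∀ {x y} → x < y → exp x < exp y
    exp-mono-< {x} {y} x<y = <-≤-trans
      (<-by (0<x*y (0<exp x) (x<y⇒0<y-x x<y))
        (solve 2 (λ e d → e :* (con (+ 1) :+ d) :- e := e :* d) refl (exp x) (y - x)))
      (exp-tangent x y)

    exp-cancel : ∀ {x y} → exp x ≤ exp y → x ≤ y
    exp-cancel {x} {y} p with x ≤? y
    ... | yes x≤y = x≤y
    ... | no  x≰y = ⊥-elim (<⇒≰ (exp-mono-< (≰⇒> x≰y)) p)

    -- The tangent to `exp` at `log u`, evaluated at `log v`; both arguments must be positive
    -- because `log` is specified only there.
    log-tangent : ∀ {u v} → 0# < u → 0# < v → u * (1# + (log v - log u)) ≤ v
    log-tangent {u} {v} 0<u 0<v = ≤-respˡ (*-congʳ (exp-log u 0<u))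
      (≤-respʳ (exp-log v 0<v) (exp-tangent (log u) (log v)))

    log-cancel : ∀ {u v} → 0# < u → 0# < v → log u ≤ log v → u ≤ v
    log-cancel 0<u 0<v p = ≤-respˡ (exp-log _ 0<u) (≤-respʳ (exp-log _ 0<v) (exp-mono p))

-- Sums over users.

module FiniteSums {c ℓ₁ ℓ₂} (R : RealNumbers c ℓ₁ ℓ₂) where
  open RealNumbers R hiding (zero)
  open OrderedField R

  -- The Kronecker delta, defined by recursion on the indices so that `sum-𝟙` can follow the
  -- recursion of `sum`.
  𝟙 : ∀ {n} → Fin n → Fin n → Carrier
  𝟙 zero    zero    = 1#
  𝟙 zero    (suc j) = 0#
  𝟙 (suc i) zero    = 0#
  𝟙 (suc i) (suc j) = 𝟙 i j

  𝟙-refl : ∀ {n} (i : Fin n) → 𝟙 i i ≡ 1#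
  𝟙-refl zero    = ≡.refl
  𝟙-refl (suc i) = 𝟙-refl i

  𝟙-≢ : ∀ {n} {i j : Fin n} → ¬ (i ≡ j) → 𝟙 i j ≡ 0#
  𝟙-≢ {i = zero}  {zero}  i≢j = ⊥-elim (i≢j ≡.refl)
  𝟙-≢ {i = zero}  {suc j} i≢j = ≡.refl
  𝟙-≢ {i = suc i} {zero}  i≢j = ≡.refl
  𝟙-≢ {i = suc i} {suc j} i≢j = 𝟙-≢ (i≢j ∘ ≡.cong suc)

  abstract
    0≤𝟙 : ∀ {n} (i j : Fin n) → 0# ≤ 𝟙 i j
    0≤𝟙 zero    zero    = <⇒≤ 0<1
    0≤𝟙 zero    (suc j) = ≤-refl
    0≤𝟙 (suc i) zero    = ≤-refl
    0≤𝟙 (suc i) (suc j) = 0≤𝟙 i j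

    sum-0 : ∀ {n} (f : Fin n → Carrier) → ∑[ j < n ] (f j * 0#) ≈ 0#
    sum-0 {zero}  f = refl
    sum-0 {suc n} f = trans (+-cong (zeroʳ _) (sum-0 (f ∘ suc))) (+-identityˡ 0#)

    sum-𝟙 : ∀ {n} (f : Fin n → Carrier) i → ∑[ j < n ] (f j * 𝟙 i j) ≈ f i
    sum-𝟙 f zero    = trans (+-cong (*-identityʳ _) (sum-0 (f ∘ suc))) (+-identityʳ _)
    sum-𝟙 f (suc i) = trans (+-cong (zeroʳ _) (sum-𝟙 (f ∘ suc) i)) (+-identityˡ _)

    sum-mono : ∀ {n} {f g : Fin n → Carrier} → (∀ j → f j ≤ g j) → sum f ≤ sum g
    sum-mono {zero}  f≤g = ≤-refl
    sum-mono {suc n} f≤g = +-mono (f≤g zero) (sum-mono (f≤g ∘ suc))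

    sum-mono-< : ∀ {n} {f g : Fin n → Carrier} i → (∀ j → f j ≤ g j) → f i < g i → sum f < sum g
    sum-mono-< zero f≤g f<g = +-mono-<-≤ f<g (sum-mono (f≤g ∘ suc))
    sum-mono-< {suc n} {f} {g} (suc i) f≤g f<g =
      <-respʳ (+-comm _ _) (≤-<-trans (≤-reflexive (+-comm _ _))
        (+-mono-<-≤ (sum-mono-< i (f≤g ∘ suc) f<g) (f≤g zero)))

    summand≤sum : ∀ {n} {f : Fin n → Carrier} → (∀ j → 0# ≤ f j) → ∀ i → f i ≤ sum f
    summand≤sum {suc n} {f} 0≤f zero    = ≤-by (sum-nonneg (0≤f ∘ suc))
      (solve 2 (λ x s → x :+ s :- x := s) refl (f zero) (sum (f ∘ suc)))
      where
      sum-nonneg : ∀ {n} {f : Fin n → Carrier} → (∀ j → 0# ≤ f j) → 0# ≤ sum f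
      sum-nonneg {zero}  0≤f = ≤-refl
      sum-nonneg {suc n} 0≤f = 0≤x+y (0≤f zero) (sum-nonneg (0≤f ∘ suc))
    summand≤sum {suc n} {f} 0≤f (suc i) = ≤-trans (summand≤sum (0≤f ∘ suc) i)
      (≤-by (0≤f zero) (solve 2 (λ x s → x :+ s :- s := x) refl (f zero) (sum (f ∘ suc))))

    smaller-positive : ∀ {p q} → 0# < p → 0# < q → ∃[ d ] (0# < d × d ≤ p × d ≤ q)
    smaller-positive {p} {q} 0<p 0<q with ≤-total p q
    ... | inj₁ p≤q = p , 0<p , ≤-refl , p≤q
    ... | inj₂ q≤p = q , 0<q , q≤p , ≤-refl

-- First-order condition for the entropic projection.

module Projection {c ℓ₁ ℓ₂} (R : RealNumbers c ℓ₁ ℓ₂) (E : ExpLog R) (N : ℕ) where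
  open RealNumbers R
  open ExpLog E
  open Allocation R E N
  open OrderedField R
  open Limits R using (½; 0<½; x½+x½≈x)
  open FiniteSums R
  open Exponential R E
  open Algebra.Properties.Semiring.Sum semiring using (∑-distrib-+)

  abstract
    -- Convexity of f(z) = z log(z/y), whose derivative is 1 + log(z/y). The tangent is taken at the
    -- new point z and not at x, because the increase f(z) - f(x) has to be bounded from above.
    entropy-tangent : ∀ {x y z} → 0# < x → 0# < y → 0# < z →
      z * log (z / y) ≤ x * log (x / y) + (1# + log (z / y)) * (z - x)
    entropy-tangent {x} {y} {z} 0<x 0<y 0<z = ≤-by (x≤y⇒0≤y-x (begin
      x * (1# + (lz - lx))            ≈⟨ *-congʳ (x/y*y≈x 0<y) ⟨
      x / y * y * (1# + (lz - lx))    ≈⟨ solve 3 (λ q y t → q :* y :* t := q :* t :* y) refl (x / y) y (1# + (lz - lx)) ⟩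
      x / y * (1# + (lz - lx)) * y    ≤⟨ *-monoʳ (<⇒≤ 0<y) (log-tangent (0<x/y 0<x 0<y) (0<x/y 0<z 0<y)) ⟩
      z / y * y                       ≈⟨ x/y*y≈x 0<y ⟩
      z                               ∎))
      (solve 4 (λ x z lx lz → x :* lx :+ (con (+ 1) :+ lz) :* (z :- x) :- z :* lz
                                := z :- x :* (con (+ 1) :+ (lz :- lx))) refl x z lx lz)
      where
      open ≤-Reasoning
      lx lz : Carrier
      lx = log (x / y)
      lz = log (z / y)

  module _ {ε : Carrier} {y x : Fin N → Carrier} (0<floor : 0# < ε / fromℕ N)
           (0<y : ∀ j → 0# < y j) (proj : IsProjection ε y x) where
    open IsProjection proj
    open InSimplex inSimplex

    floor : Carrier
    floor = ε / fromℕ N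

    0<x : ∀ j → 0# < x j
    0<x j = <-≤-trans 0<floor (lower-bound j)

    module Shift {a b : Fin N} (a≢b : ¬ (a ≡ b)) {d : Carrier} (0<d : 0# < d)
                 (d≤xa-floor : d ≤ x a - floor) where

      shifted : Fin N → Carrier
      shifted j = x j + (d * 𝟙 b j + - d * 𝟙 a j)

      abstract
        shifted-a : shifted a ≈ x a - d
        shifted-a = trans (+-congˡ (+-cong (*-congˡ (reflexive (𝟙-≢ (a≢b ∘ ≡.sym)))) (*-congˡ (reflexive (𝟙-refl a)))))
          (solve 2 (λ x d → x :+ (d :* con (+ 0) :+ :- d :* con (+ 1)) := x :- d) refl (x a) d)

        shifted-b : shifted b ≈ x b + d
        shifted-b = trans (+-congˡ (+-cong (*-congˡ (reflexive (𝟙-refl b))) (*-congˡ (reflexive (𝟙-≢ a≢b)))))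
          (solve 2 (λ x d → x :+ (d :* con (+ 1) :+ :- d :* con (+ 0)) := x :+ d) refl (x b) d)

        shifted-total : sum shifted ≈ 1#
        shifted-total = begin
          sum shifted
            ≈⟨ ∑-distrib-+ x (λ j → d * 𝟙 b j + - d * 𝟙 a j) ⟩
          sum x + ∑[ j < N ] (d * 𝟙 b j + - d * 𝟙 a j)
            ≈⟨ +-cong total-one (∑-distrib-+ (λ j → d * 𝟙 b j) (λ j → - d * 𝟙 a j)) ⟩
          1# + (∑[ j < N ] (d * 𝟙 b j) + ∑[ j < N ] (- d * 𝟙 a j))
            ≈⟨ +-congˡ (+-cong (sum-𝟙 (λ _ → d) b) (sum-𝟙 (λ _ → - d) a)) ⟩
          1# + (d - d)
            ≈⟨ solve 1 (λ d → con (+ 1) :+ (d :- d) := con (+ 1)) refl d ⟩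
          1# ∎
          where open ≈-Reasoning

        shifted-floor : ∀ j → floor ≤ shifted j
        shifted-floor j with a Finₚ.≟ j
        ... | yes ≡.refl = ≤-respʳ (sym shifted-a) (≤-by (x≤y⇒0≤y-x d≤xa-floor)
          (solve 3 (λ x d f → x :- d :- f := x :- f :- d) refl (x a) d floor))
        ... | no  a≢j    = ≤-trans (lower-bound j) (≤-by (0≤x*y (<⇒≤ 0<d) (0≤𝟙 b j))
          (trans (+-congʳ (+-congˡ (+-congˡ (*-congˡ (reflexive (𝟙-≢ a≢j))))))
            (solve 3 (λ x d t → x :+ (d :* t :+ :- d :* con (+ 0)) :- x := d :* t) refl (x j) d (𝟙 b j))))

        0<shifted : ∀ j → 0# < shifted j
        0<shifted j = <-≤-trans 0<floor (shifted-floor j)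

        -- The derivative of z log(z / y j) at z = `shifted j`.
        slope : Fin N → Carrier
        slope j = 1# + log (shifted j / y j)

        entropy-shift : relativeEntropy shifted y ≤
          relativeEntropy x y + (slope b * d + slope a * - d)
        entropy-shift = begin
          relativeEntropy shifted y
            ≤⟨ sum-mono (λ j → ≤-trans (entropy-tangent (0<x j) (0<y j) (0<shifted j))
                 (≤-reflexive (solve 6 (λ u l x d p q → u :+ l :* (x :+ (d :* p :+ :- d :* q) :- x)
                     := u :+ (l :* d :* p :+ l :* :- d :* q)) refl
                   (x j * log (x j / y j)) (slope j) (x j) d (𝟙 b j) (𝟙 a j)))) ⟩
          ∑[ j < N ] (x j * log (x j / y j) + (slope j * d * 𝟙 b j + slope j * - d * 𝟙 a j))
            ≈⟨ ∑-distrib-+ (λ j → x j * log (x j / y j)) (λ j → slope j * d * 𝟙 b j + slope j * - d * 𝟙 a j) ⟩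
          relativeEntropy x y + ∑[ j < N ] (slope j * d * 𝟙 b j + slope j * - d * 𝟙 a j)
            ≈⟨ +-congˡ (∑-distrib-+ (λ j → slope j * d * 𝟙 b j) (λ j → slope j * - d * 𝟙 a j)) ⟩
          relativeEntropy x y + (∑[ j < N ] (slope j * d * 𝟙 b j) + ∑[ j < N ] (slope j * - d * 𝟙 a j))
            ≈⟨ +-congˡ (+-cong (sum-𝟙 (λ j → slope j * d) b) (sum-𝟙 (λ j → slope j * - d) a)) ⟩
          relativeEntropy x y + (slope b * d + slope a * - d) ∎
          where open ≤-Reasoning

        -- Minimality of `x` makes the bound of `entropy-shift` nonnegative: 0 ≤ (slope b - slope a)
        -- * d.
        slope-order : slope a ≤ slope b
        slope-order = *-cancelʳ-≤ 0<d (≤-by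
          (x≤y⇒0≤y-x (≤-trans (minimal shifted (record { total-one = shifted-total ; lower-bound = shifted-floor }))
            entropy-shift))
          (solve 4 (λ p q d r → q :* d :- p :* d := r :+ (q :* d :+ p :* :- d) :- r) refl
            (slope a) (slope b) d (relativeEntropy x y)))

        ratio-order : shifted a * y b ≤ shifted b * y a
        ratio-order = begin
          shifted a * y b
            ≈⟨ *-congʳ (x/y*y≈x (0<y a)) ⟨
          shifted a / y a * y a * y b
            ≈⟨ *-assoc _ _ _ ⟩
          shifted a / y a * (y a * y b)
            ≤⟨ *-monoʳ (<⇒≤ (0<x*y (0<y a) (0<y b)))
                 (log-cancel (0<x/y (0<shifted a) (0<y a)) (0<x/y (0<shifted b) (0<y b)) log≤log) ⟩
          shifted b / y b * (y a * y b)
            ≈⟨ solve 3 (λ q y z → q :* (y :* z) := q :* z :* y) refl (shifted b / y b) (y a) (y b) ⟩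
          shifted b / y b * y b * y a
            ≈⟨ *-congʳ (x/y*y≈x (0<y b)) ⟩
          shifted b * y a ∎
          where
          open ≤-Reasoning
          log≤log : log (shifted a / y a) ≤ log (shifted b / y b)
          log≤log = ≤-by (x≤y⇒0≤y-x slope-order)
            (solve 2 (λ p q → q :- p := con (+ 1) :+ q :- (con (+ 1) :+ p)) refl (log (shifted a / y a)) (log (shifted b / y b)))

    abstract
      -- Moving mass d from a to b cannot decrease the relative entropy; by
      -- convexity this bounds the ratios after the move, and then d → 0.
      projection-ratio : ∀ a b → floor < x a → x a * y b ≤ x b * y a
      projection-ratio a b floor<xa with a Finₚ.≟ b
      ... | yes ≡.refl = ≤-refl
      ... | no  a≢b with (x a * y b) ≤? (x b * y a)
      ...   | yes p = p
      ...   | no  p = ⊥-elim (<⇒≰ gap½<gap gap≤gap½)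
        where
        gap S : Carrier
        gap = x a * y b - x b * y a
        S   = y a + y b
        0<gap : 0# < gap
        0<gap = x<y⇒0<y-x (≰⇒> p)
        0<S : 0# < S
        0<S = 0<x+y (0<y a) (<⇒≤ (0<y b))
        gap½<gap : gap * ½ < gap
        gap½<gap = <-by (0<x*y 0<gap 0<½)
          (trans (+-congʳ (sym (x½+x½≈x gap))) (solve 1 (λ h → h :+ h :- h := h) refl (gap * ½)))
        gap≤gap½ : gap ≤ gap * ½
        -- A transfer of d changes the cross-product difference by d * S, and `ratio-order` says
        -- that this absorbs all of `gap`. Hence d is taken at most gap/(2S), and also small enough
        -- to keep user a above the floor.
        gap≤gap½ with smaller-positive (x<y⇒0<y-x floor<xa) (0<x/y (0<x*y 0<gap 0<½) 0<S)
        ... | d , 0<d , d≤xa-floor , d≤gap½/S = begin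
          gap               ≤⟨ ≤-by (x≤y⇒0≤y-x (≤-respˡ (*-congʳ shifted-a) (≤-respʳ (*-congʳ shifted-b) ratio-order)))
                                 (solve 5 (λ u v p q d → d :* (p :+ q) :- (u :* q :- v :* p)
                                      := (v :+ d) :* p :- (u :- d) :* q) refl (x a) (x b) (y a) (y b) d) ⟩
          d * S             ≤⟨ *-monoʳ (<⇒≤ 0<S) d≤gap½/S ⟩
          gap * ½ / S * S   ≈⟨ x/y*y≈x 0<S ⟩
          gap * ½           ∎
          where
          open ≤-Reasoning
          open Shift a≢b 0<d d≤xa-floor

-- Growth and stability in one multiplicative step.

module MultiplicativeUpdate {c ℓ₁ ℓ₂} (R : RealNumbers c ℓ₁ ℓ₂) (E : ExpLog R) (N : ℕ) where
  open RealNumbers R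
  open Allocation R E N
  open OrderedField R
  open FiniteSums R
  open Projection R E N using (projection-ratio)
  open Algebra.Properties.Semiring.Sum semiring using (∑-distrib-+; *-distribˡ-sum)

  module _ {ε : Carrier} {w x e : Fin N → Carrier} {e₁ e₂ κ : Carrier}
           (0<floor : 0# < ε / fromℕ N) (w∈Δ : InSimplex ε w) (0<e : ∀ a → 0# < e a)
           (proj : IsProjection ε (λ a → w a * e a) x)
           (e≤e₂ : ∀ a → e a ≤ e₂) (0<κ : 0# < κ) where
    open InSimplex w∈Δ renaming (total-one to sum-w; lower-bound to floor≤w)
    open InSimplex (IsProjection.inSimplex proj) renaming (total-one to sum-x; lower-bound to floor≤x)

    private
      φ : Carrier
      φ = ε / fromℕ N

    abstract
      0<w : ∀ a → 0# < w a
      0<w a = <-≤-trans 0<floor (floor≤w a)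

      -- Control of one user controls all users above the floor: the ratio x a / (w a * e a) is at
      -- most x i / (w i * e i), hence at most r / e i.
      ratio-bound : ∀ {r} i a → x i ≤ r * w i → φ < x a → x a * e i ≤ r * (w a * e a)
      ratio-bound {r} i a xi≤ φ<xa = *-cancelʳ-≤ (0<w i) (begin
        x a * e i * w i          ≈⟨ solve 3 (λ x e w → x :* e :* w := x :* (w :* e)) refl (x a) (e i) (w i) ⟩
        x a * (w i * e i)        ≤⟨ projection-ratio 0<floor (λ b → 0<x*y (0<w b) (0<e b)) proj a i φ<xa ⟩
        x i * (w a * e a)        ≤⟨ *-monoʳ (<⇒≤ (0<x*y (0<w a) (0<e a))) xi≤ ⟩
        r * w i * (w a * e a)    ≈⟨ solve 3 (λ r w p → r :* w :* p := r :* p :* w) refl r (w i) (w a * e a) ⟩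
        r * (w a * e a) * w i    ∎)
        where open ≤-Reasoning

    module Growth (0<e₁ : 0# < e₁) (1+κ≤e₂ : 1# + κ ≤ e₂) (e₁[1+κ]≤e₂ : e₁ * (1# + κ) ≤ e₂)
                  (i j : Fin N) (ei≡e₂ : e i ≡ e₂) (ej≤e₁ : e j ≤ e₁) (e₂φ≤wj : e₂ * φ ≤ w j) where

      δ : Carrier
      δ = κ * φ

      abstract
        0<δ : 0# < δ
        0<δ = 0<x*y 0<κ 0<floor

        0<1+δ : 0# < 1# + δ
        0<1+δ = 0<x+y 0<1 (<⇒≤ 0<δ)

        0<1+κ : 0# < 1# + κ
        0<1+κ = 0<x+y 0<1 (<⇒≤ 0<κ)

        0<e₂ : 0# < e₂
        0<e₂ = <-≤-trans 0<1+κ 1+κ≤e₂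

        -- User j has at least κφ = δ above the floor, so even a fall to the floor frees that much.
        φ[1+κ]≤wj : φ * (1# + κ) ≤ w j
        φ[1+κ]≤wj = ≤-trans (≤-respʳ (*-comm _ _) (*-monoˡ (<⇒≤ 0<floor) 1+κ≤e₂)) e₂φ≤wj

        module _ (xi≤ : x i ≤ (1# + δ) * w i) where

          -- User i has the largest factor `e₂`, so if i does not grow by more than 1 + δ, nobody
          -- does.
          x≤[1+δ]w : ∀ a → x a ≤ (1# + δ) * w a
          x≤[1+δ]w a with x a ≤? φ
          ... | yes xa≤φ = ≤-trans xa≤φ (≤-trans (floor≤w a) (≤-by (0≤x*y (<⇒≤ 0<δ) (<⇒≤ (0<w a)))
            (solve 2 (λ d w → (con (+ 1) :+ d) :* w :- w := d :* w) refl δ (w a))))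
          ... | no  xa≰φ = *-cancelʳ-≤ 0<e₂ (begin
            x a * e₂                   ≡⟨ ≡.cong (x a *_) ei≡e₂ ⟨
            x a * e i                  ≤⟨ ratio-bound i a xi≤ (≰⇒> xa≰φ) ⟩
            (1# + δ) * (w a * e a)     ≈⟨ *-assoc _ _ _ ⟨
            (1# + δ) * w a * e a       ≤⟨ *-monoˡ (0≤x*y (<⇒≤ 0<1+δ) (<⇒≤ (0<w a))) (e≤e₂ a) ⟩
            (1# + δ) * w a * e₂        ∎)
            where open ≤-Reasoning

          -- Above the floor, the missing bonus divides the bound for j by a further 1 + κ, which
          -- saves κ/(1 + κ) of (1 + δ) * w j, at least δ(1 + δ). At the floor, w j ≥ φ + δ
          -- suffices. Since the total of (1 + δ) * w is 1 + δ, a saving of more than δ pushes the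
          -- sum of x below 1.
          xj<[1+δ]wj-δ : x j < (1# + δ) * w j - δ
          xj<[1+δ]wj-δ with x j ≤? φ
          ... | yes xj≤φ = ≤-<-trans xj≤φ (<-by
            (0<x+y (0<x*y 0<δ (0<w j)) (x≤y⇒0≤y-x φ[1+κ]≤wj))
            (solve 3 (λ k f w → (con (+ 1) :+ k :* f) :* w :- k :* f :- f
                       := k :* f :* w :+ (w :- f :* (con (+ 1) :+ k))) refl κ φ (w j)))
          ... | no  xj≰φ = *-cancelʳ-< (<⇒≤ 0<1+κ) (begin-strict
            x j * (1# + κ)
              ≤⟨ *-cancelʳ-≤ 0<e₁ (begin
                   x j * (1# + κ) * e₁        ≈⟨ solve 3 (λ x k e → x :* k :* e := x :* (e :* k)) refl (x j) (1# + κ) e₁ ⟩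
                   x j * (e₁ * (1# + κ))      ≤⟨ *-monoˡ (≤-trans (<⇒≤ 0<floor) (floor≤x j)) e₁[1+κ]≤e₂ ⟩
                   x j * e₂                   ≡⟨ ≡.cong (x j *_) ei≡e₂ ⟨
                   x j * e i                  ≤⟨ ratio-bound i j xi≤ (≰⇒> xj≰φ) ⟩
                   (1# + δ) * (w j * e j)     ≈⟨ *-assoc _ _ _ ⟨
                   (1# + δ) * w j * e j       ≤⟨ *-monoˡ (0≤x*y (<⇒≤ 0<1+δ) (<⇒≤ (0<w j))) ej≤e₁ ⟩
                   (1# + δ) * w j * e₁        ∎) ⟩
            (1# + δ) * w j
              <⟨ <-by
                   (0<x+y (0<x*y (0<x*y 0<δ 0<δ) 0<1+κ)
                      (0≤x*y (0≤x*y (<⇒≤ 0<1+δ) (<⇒≤ 0<κ)) (x≤y⇒0≤y-x φ[1+κ]≤wj)))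
                   (solve 3 (λ k f w →
                      ((con (+ 1) :+ k :* f) :* w :- k :* f) :* (con (+ 1) :+ k) :- (con (+ 1) :+ k :* f) :* w
                        := k :* f :* (k :* f) :* (con (+ 1) :+ k)
                           :+ (con (+ 1) :+ k :* f) :* k :* (w :- f :* (con (+ 1) :+ k))) refl κ φ (w j)) ⟩
            ((1# + δ) * w j - δ) * (1# + κ) ∎)
            where open ≤-Reasoning

          sum-x<1 : sum x < 1#
          sum-x<1 = <-≤-trans (sum-mono-< j pointwise strict) (≤-reflexive (begin
            ∑[ a < N ] ((1# + δ) * w a + - δ * 𝟙 j a)
              ≈⟨ ∑-distrib-+ (λ a → (1# + δ) * w a) (λ a → - δ * 𝟙 j a) ⟩
            ∑[ a < N ] ((1# + δ) * w a) + ∑[ a < N ] (- δ * 𝟙 j a)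
              ≈⟨ +-cong (sym (*-distribˡ-sum (1# + δ) w)) (sum-𝟙 (λ _ → - δ) j) ⟩
            (1# + δ) * sum w - δ
              ≈⟨ +-congʳ (*-congˡ sum-w) ⟩
            (1# + δ) * 1# - δ
              ≈⟨ solve 1 (λ d → (con (+ 1) :+ d) :* con (+ 1) :- d := con (+ 1)) refl δ ⟩
            1# ∎))
            where
            open ≈-Reasoning
            strict : x j < (1# + δ) * w j + - δ * 𝟙 j j
            strict = <-respʳ (+-congˡ (sym (trans (*-congˡ (reflexive (𝟙-refl j))) (*-identityʳ _)))) xj<[1+δ]wj-δ
            pointwise : ∀ a → x a ≤ (1# + δ) * w a + - δ * 𝟙 j a
            pointwise a with j Finₚ.≟ a
            ... | yes ≡.refl = <⇒≤ strict
            ... | no  j≢a    = ≤-respʳ (trans (sym (+-identityʳ _))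
              (+-congˡ (sym (trans (*-congˡ (reflexive (𝟙-≢ j≢a))) (zeroʳ _))))) (x≤[1+δ]w a)

        growth : (1# + δ) * w i ≤ x i
        growth with ((1# + δ) * w i) ≤? x i
        ... | yes p = p
        ... | no  p = ⊥-elim (<⇒≰ (sum-x<1 (<⇒≤ (≰⇒> p))) (≤-reflexive (sym sum-x)))

    abstract
      -- If i shrank by more than 1 - κ, then `ratio-bound` with r = 1 - κ would leave no user
      -- larger than before: even the largest factor satisfies e₂(1 - κ) ≤ e₁ ≤ e i. The total would
      -- then fall below 1.
      stability : e₂ * (1# - κ) ≤ e₁ → ∀ i → e₁ ≤ e i → (1# - κ) * w i ≤ x i
      stability e₂[1-κ]≤e₁ i e₁≤ei with ((1# - κ) * w i) ≤? x i
      ... | yes p = p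
      ... | no  p = ⊥-elim (<⇒≰ (sum-mono-< i x≤w xi<wi) (≤-reflexive (trans sum-w (sym sum-x))))
        where
        open ≤-Reasoning
        x≤w : ∀ a → x a ≤ w a
        x≤w a with x a ≤? φ
        ... | yes xa≤φ = ≤-trans xa≤φ (floor≤w a)
        ... | no  xa≰φ with (1# - κ) ≤? 0#
        -- Here x i < (1 - κ) * w i ≤ 0 contradicts the positive floor.
        ...   | yes 1-κ≤0 = ⊥-elim (<⇒≰ (<-≤-trans 0<floor (floor≤x i)) (≤-trans (<⇒≤ (≰⇒> p))
                  (≤-respʳ (zeroˡ _) (*-monoʳ (<⇒≤ (0<w i)) 1-κ≤0))))
        ...   | no  1-κ≰0 = *-cancelʳ-≤ (0<e i) (begin
          x a * e i                  ≤⟨ ratio-bound i a (<⇒≤ (≰⇒> p)) (≰⇒> xa≰φ) ⟩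
          (1# - κ) * (w a * e a)     ≈⟨ solve 3 (λ k w e → k :* (w :* e) := w :* (e :* k)) refl (1# - κ) (w a) (e a) ⟩
          w a * (e a * (1# - κ))     ≤⟨ *-monoˡ (<⇒≤ (0<w a)) (*-monoʳ (<⇒≤ (≰⇒> 1-κ≰0)) (e≤e₂ a)) ⟩
          w a * (e₂ * (1# - κ))      ≤⟨ *-monoˡ (<⇒≤ (0<w a)) (≤-trans e₂[1-κ]≤e₁ e₁≤ei) ⟩
          w a * e i                  ∎)
        xi<wi : x i < w i
        xi<wi = <-≤-trans (≰⇒> p) (≤-by (0≤x*y (<⇒≤ 0<κ) (<⇒≤ (0<w i)))
          (solve 2 (λ k w → w :- (con (+ 1) :- k) :* w := k :* w) refl κ (w i)))

-- Queues, work and busy periods.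

module Queueing {c ℓ₁ ℓ₂} (R : RealNumbers c ℓ₁ ℓ₂) (E : ExpLog R) (N : ℕ) where
  open RealNumbers R
  open Allocation R E N
  open OrderedField R
  open PartialSums R
  open import Algebra.Construct.NaturalChoice.Min totalOrder using (x≤y⇒x⊓y≈x; x≤y⇒y⊓x≈x; x⊓y≤x; ⊓-glb)
  open import Algebra.Construct.NaturalChoice.Max totalOrder using (x≤y⇒x⊔y≈y; x≤y⇒y⊔x≈y; x≤x⊔y)

  abstract
    served+unserved : ∀ h x → h ⊓ x + (0# ⊔ (x - h)) ≈ x
    served+unserved h x = [ underload , overload ]′ (≤-total h x)
      where
      underload : h ≤ x → h ⊓ x + (0# ⊔ (x - h)) ≈ x
      underload h≤x = trans (+-cong (x≤y⇒x⊓y≈x h≤x) (x≤y⇒x⊔y≈y (x≤y⇒0≤y-x h≤x)))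
        (solve 2 (λ h x → h :+ (x :- h) := x) refl h x)
      overload : x ≤ h → h ⊓ x + (0# ⊔ (x - h)) ≈ x
      overload x≤h = trans (+-cong (x≤y⇒y⊓x≈x x≤h) (x≤y⇒y⊔x≈y
        (≤-by (x≤y⇒0≤y-x x≤h) (solve 2 (λ h x → con (+ 0) :- (x :- h) := h :- x) refl h x)))) (+-identityʳ x)

  module _ (h : Allocations) (L : Loads) (i : Fin N) where

    W F A : Seq
    W s = work h L s i
    F s = L s i
    A s = h s i

    Q : ℕ → Carrier
    Q s = queue h L s i

    abstract
      0≤Q : ∀ s → 0# ≤ Q s
      0≤Q zero    = ≤-refl
      0≤Q (suc s) = x≤x⊔y 0# (F s + Q s - A s)

      W≤A : ∀ s → W s ≤ A s
      W≤A s = x⊓y≤x (A s) (F s + Q s)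

      0≤W : ∀ {s} → 0# ≤ A s → 0# ≤ F s → 0# ≤ W s
      0≤W {s} 0≤A 0≤F = ⊓-glb 0≤A (0≤x+y 0≤F (0≤Q s))

      0<Q⇒W≈A : ∀ s → 0# < Q (suc s) → W s ≈ A s
      0<Q⇒W≈A s 0<Q = [ x≤y⇒x⊓y≈x , (λ F+Q≤A → ⊥-elim (<⇒≰ 0<Q (≤-reflexive (x≤y⇒y⊔x≈y
        (≤-by (x≤y⇒0≤y-x F+Q≤A) (solve 2 (λ h x → con (+ 0) :- (x :- h) := h :- x) refl (A s) (F s + Q s))))))) ]′
        (≤-total (A s) (F s + Q s))

      work-balance : ∀ t → Σ< W t + Q t ≈ Σ< F t
      work-balance zero    = +-identityˡ 0#
      work-balance (suc t) = begin
        Σ< W (suc t) + Q (suc t)                    ≈⟨ +-congʳ (Σ<-suc W t) ⟩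
        Σ< W t + W t + Q (suc t)                    ≈⟨ +-assoc _ _ _ ⟩
        Σ< W t + (W t + Q (suc t))                  ≈⟨ +-congˡ (served+unserved (A t) (F t + Q t)) ⟩
        Σ< W t + (F t + Q t)                        ≈⟨ solve 3 (λ w f q → w :+ (f :+ q) := w :+ q :+ f) refl (Σ< W t) (F t) (Q t) ⟩
        Σ< W t + Q t + F t                          ≈⟨ +-congʳ (work-balance t) ⟩
        Σ< F t + F t                                ≈⟨ Σ<-suc F t ⟨
        Σ< F (suc t)                                ∎
        where open ≈-Reasoning

      ΣW≤ΣF : ∀ t → Σ< W t ≤ Σ< F t
      ΣW≤ΣF t = ≤-by (0≤Q t) (trans (+-congʳ (sym (work-balance t)))
        (solve 2 (λ w q → w :+ q :- w := q) refl (Σ< W t) (Q t)))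

    -- The user is inactive at `s` and active at s + 1, ..., s + n. Work equals allocation one index
    -- earlier, at s, ..., s + n - 1, because it is the queue left after a step that shows the
    -- allocation was used up. For n = 0 the queue is empty now.
    BusySince : ℕ → ℕ → Set _
    BusySince s n = Q s ≈ 0# × (∀ j → j ℕ.< n → 0# < Q (s ℕ.+ suc j))

    abstract
      busy-period : ∀ t → ∃[ s ] ∃[ n ] (s ℕ.+ n ≡ t × BusySince s n)
      busy-period zero    = 0 , 0 , ≡.refl , refl , λ _ ()
      busy-period (suc t) with 0# <? Q (suc t)
      ... | no  0≮Q = suc t , 0 , ℕₚ.+-identityʳ (suc t) , Q≈0 , λ _ ()
        where
        Q≈0 : Q (suc t) ≈ 0#
        Q≈0 with Q (suc t) ≤? 0#
        ... | yes Q≤0 = antisym Q≤0 (0≤Q (suc t))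
        ... | no  Q≰0 = ⊥-elim (0≮Q (≰⇒> Q≰0))
      ... | yes 0<Q with busy-period t
      ...   | s , n , s+n≡t , Q≈0 , busy =
        s , suc n , s+1+n≡1+t , Q≈0 , λ j j<1+n →
          [ busy j , (λ { ≡.refl → ≡.subst (λ k → 0# < Q k) (≡.sym s+1+n≡1+t) 0<Q }) ]′
          (ℕₚ.m<1+n⇒m<n∨m≡n j<1+n)
        where
        s+1+n≡1+t : s ℕ.+ suc n ≡ suc t
        s+1+n≡1+t = ≡.trans (ℕₚ.+-suc s n) (≡.cong suc s+n≡t)

      busy-work : ∀ {s n} → BusySince s n → Σ< W (s ℕ.+ n) ≈ Σ< F s + Σ< (λ j → A (s ℕ.+ j)) n
      busy-work {s} {n} (Q≈0 , busy) = begin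
        Σ< W (s ℕ.+ n)                              ≈⟨ Σ<-+ W s n ⟩
        Σ< W s + Σ< (λ j → W (s ℕ.+ j)) n           ≈⟨ +-cong ΣW≈ΣF (Σ<-cong-< n λ j j<n →
                                                         0<Q⇒W≈A (s ℕ.+ j) (≡.subst (λ k → 0# < Q k) (ℕₚ.+-suc s j) (busy j j<n))) ⟩
        Σ< F s + Σ< (λ j → A (s ℕ.+ j)) n           ∎
        where
        open ≈-Reasoning
        ΣW≈ΣF : Σ< W s ≈ Σ< F s
        ΣW≈ΣF = trans (sym (+-identityʳ _)) (trans (+-congˡ (sym Q≈0)) (work-balance s))

    abstract
      -- Meant for the competitor, whose queue at `s` is unknown: whatever it did before, it cannot
      -- have served more than had arrived.
      work-≤-share : ∀ {r} s q → (∀ j → j ℕ.< q → A (s ℕ.+ j) ≈ r) →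
                     Σ< W (s ℕ.+ q) ≤ Σ< F s + fromℕ q * r
      work-≤-share {r} s q A≈r = begin
        Σ< W (s ℕ.+ q)                         ≈⟨ Σ<-+ W s q ⟩
        Σ< W s + Σ< (λ j → W (s ℕ.+ j)) q      ≤⟨ +-mono (ΣW≤ΣF s) (Σ<-≤-const q λ j j<q →
                                                    ≤-respʳ (A≈r j j<q) (W≤A (s ℕ.+ j))) ⟩
        Σ< F s + fromℕ q * r                   ∎
        where
        open ≤-Reasoning

-- Estimates for the parameters and the delay.

module _ {c ℓ₁ ℓ₂} (R : RealNumbers c ℓ₁ ℓ₂) (E : ExpLog R) (N : ℕ) where
  open RealNumbers R
  open ExpLog E
  open Allocation R E N

  module Parameters
    (2≤N : 2 ℕ.≤ N) (ε η : Carrier)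
    (0<ε : 0# < ε) (ε≤1/10 : ε ≤ 1# / fromℕ 10) (0<η : 0# < η) (η≤1/3 : η ≤ 1# / fromℕ 3) where
    open OrderedField R
    open Exponential R E

    -- `κ` is the difference between the exponents of `e₂` (active with bonus) and `e₁` (active
    -- without), `φ` is the floor, and `δ` = ηε³/(8N²) is the guaranteed growth rate.
    n μ κ φ δ ℓ p e₁ e₂ : Carrier
    n  = fromℕ N
    μ  = bonus ε
    κ  = η * μ
    φ  = ε / n
    δ  = κ * φ
    ℓ  = log (n / ε)
    p  = delay ε η
    e₁ = exp (η * 1#)
    e₂ = exp (η * (1# + μ))

    abstract
      1≤n : 1# ≤ n
      1≤n = ≤-respˡ (+-identityʳ 1#) (fromℕ-mono (ℕₚ.≤-trans (ℕ.s≤s ℕ.z≤n) 2≤N))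

      0<n : 0# < n
      0<n = <-≤-trans 0<1 1≤n

      0<8n : 0# < fromℕ 8 * n
      0<8n = 0<x*y (0<fromℕ 8) 0<n

      0<ε² : 0# < ε ^ 2
      0<ε² = 0<x*y 0<ε (0<x*y 0<ε 0<1)

      0<μ : 0# < μ
      0<μ = 0<x/y 0<ε² 0<8n

      0<κ : 0# < κ
      0<κ = 0<x*y 0<η 0<μ

      0<φ : 0# < φ
      0<φ = 0<x/y 0<ε 0<n

      0<δ : 0# < δ
      0<δ = 0<x*y 0<κ 0<φ

      0<1+δ : 0# < 1# + δ
      0<1+δ = 0<x+y 0<1 (<⇒≤ 0<δ)

      10ε≤1 : ε * fromℕ 10 ≤ 1#
      10ε≤1 = ≤-respʳ (x/y*y≈x (0<fromℕ 10)) (*-monoʳ (0≤fromℕ 10) ε≤1/10)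

      3η≤1 : η * fromℕ 3 ≤ 1#
      3η≤1 = ≤-respʳ (x/y*y≈x (0<fromℕ 3)) (*-monoʳ (0≤fromℕ 3) η≤1/3)

      2ε≤1 : fromℕ 2 * ε ≤ 1#
      2ε≤1 = ≤-by (0≤x+y (x≤y⇒0≤y-x 10ε≤1) (0≤x*y (0≤fromℕ 8) (<⇒≤ 0<ε)))
        (solve 1 (λ e → con (+ 1) :- con (+ 2) :* e := con (+ 1) :- e :* con (+ 10) :+ con (+ 8) :* e) refl ε)

      ε≤1 : ε ≤ 1#
      ε≤1 = ≤-trans (≤-by (<⇒≤ 0<ε) (solve 1 (λ e → con (+ 2) :* e :- e := e) refl ε)) 2ε≤1

      η≤1 : η ≤ 1#
      η≤1 = ≤-trans (≤-by (0≤x*y (0≤fromℕ 2) (<⇒≤ 0<η)) (solve 1 (λ e → e :* con (+ 3) :- e := con (+ 2) :* e) refl η)) 3η≤1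

      μ≤ε : μ ≤ ε
      μ≤ε = begin
        μ          ≤⟨ ≤-by (0≤x*y (<⇒≤ 0<μ) (0≤x+y (x≤y⇒0≤y-x 1≤n) (0≤x*y (0≤fromℕ 7) (<⇒≤ 0<n))))
                       (trans (+-congʳ (sym (x/y*y≈x 0<8n)))
                         (solve 2 (λ m n → m :* (con (+ 8) :* n) :- m := m :* (n :- con (+ 1) :+ con (+ 7) :* n)) refl μ n)) ⟩
        ε ^ 2      ≤⟨ ≤-by (0≤x*y (<⇒≤ 0<ε) (x≤y⇒0≤y-x ε≤1))
                       (solve 1 (λ e → e :- e :^ 2 := e :* (con (+ 1) :- e)) refl ε) ⟩
        ε          ∎
        where open ≤-Reasoning

      κ≤ε : κ ≤ ε
      κ≤ε = ≤-trans (≤-respʳ (*-identityˡ μ) (*-monoʳ (<⇒≤ 0<μ) η≤1)) μ≤ε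

      κ≤2ε : κ ≤ fromℕ 2 * ε
      κ≤2ε = ≤-trans κ≤ε (≤-by (<⇒≤ 0<ε) (solve 1 (λ e → con (+ 2) :* e :- e := e) refl ε))

      φ≤ε : φ ≤ ε
      φ≤ε = ≤-by (0≤x*y (<⇒≤ 0<φ) (x≤y⇒0≤y-x 1≤n)) (trans (+-congʳ (sym (x/y*y≈x 0<n)))
        (solve 2 (λ f n → f :* n :- f := f :* (n :- con (+ 1))) refl φ n))

      φ≤1 : φ ≤ 1#
      φ≤1 = ≤-trans φ≤ε ε≤1

      δ≤φ : δ ≤ φ
      δ≤φ = ≤-respʳ (*-identityˡ φ) (*-monoʳ (<⇒≤ 0<φ) (≤-trans κ≤ε ε≤1))

      δ≤1 : δ ≤ 1#
      δ≤1 = ≤-trans δ≤φ φ≤1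

      δ≤1-φ : δ ≤ 1# - φ
      δ≤1-φ = ≤-by (0≤x+y (x≤y⇒0≤y-x 2ε≤1) (0≤x+y (x≤y⇒0≤y-x φ≤ε) (x≤y⇒0≤y-x (≤-trans δ≤φ φ≤ε))))
        (solve 3 (λ e f d → con (+ 1) :- f :- d := con (+ 1) :- con (+ 2) :* e :+ (e :- f :+ (e :- d))) refl ε φ δ)

      0<n/ε : 0# < n / ε
      0<n/ε = 0<x/y 0<n 0<ε

      n/ε*φ≈1 : n / ε * φ ≈ 1#
      n/ε*φ≈1 = begin
        n * ε ⁻¹ * (ε * n ⁻¹)     ≈⟨ solve 4 (λ n i e j → n :* i :* (e :* j) := n :* j :* (e :* i)) refl n (ε ⁻¹) ε (n ⁻¹) ⟩
        n * n ⁻¹ * (ε * ε ⁻¹)     ≈⟨ *-cong (x*x⁻¹≈1 0<n) (x*x⁻¹≈1 0<ε) ⟩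
        1# * 1#                   ≈⟨ *-identityˡ 1# ⟩
        1#                        ∎
        where open ≈-Reasoning

      -- The inequality log u ≥ 1 - 1/u at u = n/ε, obtained from the tangent to `exp` at `ℓ`,
      -- evaluated at 0. With `δ≤1-φ` it makes `ℓ` large enough to pay for single extra steps.
      1-φ≤ℓ : 1# - φ ≤ ℓ
      1-φ≤ℓ = ≤-by (x≤y⇒0≤y-x (begin
        1# - ℓ                            ≈⟨ *-identityˡ _ ⟨
        1# * (1# - ℓ)                     ≈⟨ *-congʳ n/ε*φ≈1 ⟨
        n / ε * φ * (1# - ℓ)              ≈⟨ *-congʳ (*-congʳ (exp-log (n / ε) 0<n/ε)) ⟨
        exp ℓ * φ * (1# - ℓ)              ≈⟨ solve 3 (λ e f l → e :* f :* (con (+ 1) :- l)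
                                               := e :* (con (+ 1) :+ (con (+ 0) :- l)) :* f) refl (exp ℓ) φ ℓ ⟩
        exp ℓ * (1# + (0# - ℓ)) * φ       ≤⟨ *-monoʳ (<⇒≤ 0<φ) (exp-tangent ℓ 0#) ⟩
        exp 0# * φ                        ≈⟨ *-congʳ exp-0 ⟩
        1# * φ                            ≈⟨ *-identityˡ φ ⟩
        φ                                 ∎))
        (solve 2 (λ l f → l :- (con (+ 1) :- f) := f :- (con (+ 1) :- l)) refl ℓ φ)
        where open ≤-Reasoning

      δ≤ℓ : δ ≤ ℓ
      δ≤ℓ = ≤-trans δ≤1-φ 1-φ≤ℓ

      0<ℓ : 0# < ℓ
      0<ℓ = <-≤-trans 0<δ δ≤ℓ

      0<ε³η : 0# < ε ^ 3 * η
      0<ε³η = 0<x*y (0<x*y 0<ε 0<ε²) 0<η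

      pδ≈4ℓ : p * δ ≈ fromℕ 4 * ℓ
      pδ≈4ℓ = begin
        p * δ
          ≈⟨ *-congˡ (solve 4 (λ e h i j → h :* (e :^ 2 :* i) :* (e :* j) := e :^ 3 :* h :* (i :* j)) refl
             ε η ((fromℕ 8 * n) ⁻¹) (n ⁻¹)) ⟩
        fromℕ 32 * (n ^ 2 * (ε ^ 3 * η) ⁻¹) * ℓ * (ε ^ 3 * η * ((fromℕ 8 * n) ⁻¹ * n ⁻¹))
          ≈⟨ solve 6 (λ n a l x i j → con (+ 32) :* (n :^ 2 :* a) :* l :* (x :* (i :* j))
               := con (+ 4) :* l :* (x :* a :* (con (+ 8) :* n :* i :* (n :* j)))) refl
               n ((ε ^ 3 * η) ⁻¹) ℓ (ε ^ 3 * η) ((fromℕ 8 * n) ⁻¹) (n ⁻¹) ⟩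
        fromℕ 4 * ℓ * (ε ^ 3 * η * (ε ^ 3 * η) ⁻¹ * (fromℕ 8 * n * (fromℕ 8 * n) ⁻¹ * (n * n ⁻¹)))
          ≈⟨ *-congˡ (*-cong (x*x⁻¹≈1 0<ε³η) (*-cong (x*x⁻¹≈1 0<8n) (x*x⁻¹≈1 0<n))) ⟩
        fromℕ 4 * ℓ * (1# * (1# * 1#))
          ≈⟨ solve 1 (λ l → con (+ 4) :* l :* (con (+ 1) :* (con (+ 1) :* con (+ 1))) := con (+ 4) :* l) refl ℓ ⟩
        fromℕ 4 * ℓ ∎
        where open ≈-Reasoning

      e₁[1+κ]≤e₂ : e₁ * (1# + κ) ≤ e₂
      e₁[1+κ]≤e₂ = ≤-respˡ
        (*-congˡ (solve 2 (λ h m → con (+ 1) :+ (h :* (con (+ 1) :+ m) :- h :* con (+ 1)) := con (+ 1) :+ h :* m) refl η μ))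
        (exp-tangent (η * 1#) (η * (1# + μ)))

      e₂[1-κ]≤e₁ : e₂ * (1# - κ) ≤ e₁
      e₂[1-κ]≤e₁ = ≤-respˡ
        (*-congˡ (solve 2 (λ h m → con (+ 1) :+ (h :* con (+ 1) :- h :* (con (+ 1) :+ m)) := con (+ 1) :- h :* m) refl η μ))
        (exp-tangent (η * (1# + μ)) (η * 1#))

      1+κ≤e₂ : 1# + κ ≤ e₂
      1+κ≤e₂ = ≤-trans
        (≤-by (<⇒≤ 0<η) (solve 2 (λ h m → con (+ 1) :+ h :* (con (+ 1) :+ m) :- (con (+ 1) :+ h :* m) := h) refl η μ))
        (1+x≤exp (η * (1# + μ)))

      -- One step is exp (- d) ≥ 1 - d = 1/(1 + δ) for d = δ/(1 + δ). This bounds the growth time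
      -- without a logarithm of 1 + δ.
      exp≤power : ∀ j → exp (fromℕ j * (δ / (1# + δ))) ≤ (1# + δ) ^ j
      exp≤power zero    = ≤-reflexive (trans (exp-cong (zeroˡ _)) exp-0)
      exp≤power (suc j) = begin
        exp x                                    ≈⟨ *-identityʳ _ ⟨
        exp x * 1#                               ≈⟨ *-congˡ (trans (solve 1 (λ d → con (+ 1) := con (+ 1) :+ d :- d) refl δ)
                                                      (trans (+-congˡ (-‿cong (sym (x/y*y≈x 0<1+δ))))
                                                        (solve 2 (λ d c → con (+ 1) :+ d :- c :* (con (+ 1) :+ d)
                                                           := (con (+ 1) :- c) :* (con (+ 1) :+ d)) refl δ d))) ⟩
        exp x * ((1# - d) * (1# + δ))            ≈⟨ *-assoc _ _ _ ⟨
        exp x * (1# - d) * (1# + δ)              ≈⟨ *-congʳ (*-congˡ (solve 2 (λ k c → con (+ 1) :- c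
                                                      := con (+ 1) :+ (k :* c :- (con (+ 1) :+ k) :* c)) refl (fromℕ j) d)) ⟩
        exp x * (1# + (y - x)) * (1# + δ)        ≤⟨ *-monoʳ (<⇒≤ 0<1+δ) (exp-tangent x y) ⟩
        exp y * (1# + δ)                         ≤⟨ *-monoʳ (<⇒≤ 0<1+δ) (exp≤power j) ⟩
        (1# + δ) ^ j * (1# + δ)                  ≈⟨ *-comm _ _ ⟩
        (1# + δ) ^ suc j                         ∎
        where
        open ≤-Reasoning
        d x y : Carrier
        d = δ / (1# + δ)
        x = fromℕ (suc j) * d
        y = fromℕ j * d

      -- Taking logarithms gives jδ ≤ ℓ(1 + δ) ≤ 2ℓ, and two more steps cost 2δ ≤ 2ℓ; the sum is 4ℓ
      -- = pδ. Of the two, one turns the exponent j into a number j + 1 of steps, the other is the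
      -- inactive step before them.
      growth-time : ∀ j → φ * (1# + δ) ^ j ≤ 1# → fromℕ (suc (suc j)) ≤ p
      growth-time j φ[1+δ]^j≤1 = *-cancelʳ-≤ 0<δ (≤-respʳ (sym pδ≈4ℓ)
        (≤-by
          (0≤x+y (x≤y⇒0≤y-x jδ≤ℓ[1+δ]) (0≤x+y (0≤x*y (<⇒≤ 0<ℓ) (x≤y⇒0≤y-x δ≤1))
            (0≤x+y (x≤y⇒0≤y-x δ≤ℓ) (x≤y⇒0≤y-x δ≤ℓ))))
          (solve 3 (λ j d l → con (+ 4) :* l :- (con (+ 1) :+ (con (+ 1) :+ j)) :* d
              := l :* (con (+ 1) :+ d) :- j :* d :+ (l :* (con (+ 1) :- d) :+ (l :- d :+ (l :- d)))) refl (fromℕ j) δ ℓ)))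
        where
        open ≤-Reasoning
        d : Carrier
        d = δ / (1# + δ)
        jd≤ℓ : fromℕ j * d ≤ ℓ
        jd≤ℓ = exp-cancel (≤-trans (exp≤power j) (*-cancelʳ-≤ 0<φ (begin
          (1# + δ) ^ j * φ    ≈⟨ *-comm _ _ ⟩
          φ * (1# + δ) ^ j    ≤⟨ φ[1+δ]^j≤1 ⟩
          1#                  ≈⟨ n/ε*φ≈1 ⟨
          n / ε * φ           ≈⟨ *-congʳ (exp-log (n / ε) 0<n/ε) ⟨
          exp ℓ * φ           ∎)))
        jδ≤ℓ[1+δ] : fromℕ j * δ ≤ ℓ * (1# + δ)
        jδ≤ℓ[1+δ] = begin
          fromℕ j * δ                ≈⟨ *-congˡ (x/y*y≈x 0<1+δ) ⟨
          fromℕ j * (d * (1# + δ))   ≈⟨ *-assoc _ _ _ ⟨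
          fromℕ j * d * (1# + δ)     ≤⟨ *-monoʳ (<⇒≤ 0<1+δ) jd≤ℓ ⟩
          ℓ * (1# + δ)               ∎

      1≤p : 1# ≤ p
      1≤p = ≤-trans (≤-by (<⇒≤ (0<fromℕ 1)) (solve 0 (con (+ 2) :- con (+ 1) := con (+ 1) :+ con (+ 0)) refl))
        (growth-time 0 (≤-respˡ (sym (*-identityʳ φ)) φ≤1))

-- The allocation of one user along a run.

module _ {c ℓ₁ ℓ₂} (R : RealNumbers c ℓ₁ ℓ₂) (E : ExpLog R) (N : ℕ) where
  open RealNumbers R
  open ExpLog E
  open Allocation R E N

  module Run
    (2≤N : 2 ℕ.≤ N) (ε η : Carrier)
    (0<ε : 0# < ε) (ε≤1/10 : ε ≤ 1# / fromℕ 10) (0<η : 0# < η) (η≤1/3 : η ≤ 1# / fromℕ 3)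
    (β : Fin N → Carrier) (0≤β : ∀ i → 0# ≤ β i) (Σβ≤1 : (∑[ i < N ] β i) ≤ 1#)
    (e₂φ≤β : ∀ i → exp (η * (1# + bonus ε)) * (ε / fromℕ N) ≤ β i)
    (T : ℕ) (L : Loads) (h : Allocations) (run : IsRun ε η β L T h) (i : Fin N) where
    open OrderedField R
    open FiniteSums R
    open PartialSums R
    open Exponential R E
    open Queueing R E N
    open Parameters R E N 2≤N ε η 0<ε ε≤1/10 0<η η≤1/3
    open IsRun run
    open InSimplex

    -- `gain` with its two decisions made arguments: it unfolds to the same expression, and its
    -- bounds follow by matching on the decisions.
    gainOf : ∀ {a b} {P : Set a} {Q : Set b} → Dec P → Dec Q → Carrier
    gainOf active? below? = if does active? then (if does below? then 1# + μ else 1#) else 0#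

    abstract
      1≤1+μ : 1# ≤ 1# + μ
      1≤1+μ = ≤-by (<⇒≤ 0<μ) (solve 1 (λ m → con (+ 1) :+ m :- con (+ 1) := m) refl μ)

      gain≤1+μ : ∀ {a b} {P : Set a} {Q : Set b} (p? : Dec P) (q? : Dec Q) → gainOf p? q? ≤ 1# + μ
      gain≤1+μ (yes _) (yes _) = ≤-refl
      gain≤1+μ (yes _) (no _)  = 1≤1+μ
      gain≤1+μ (no _)  _       = ≤-trans (<⇒≤ 0<1) 1≤1+μ

      gain≤1 : ∀ {a b} {P : Set a} {Q : Set b} (p? : Dec P) (q? : Dec Q) → ¬ Q → gainOf p? q? ≤ 1#
      gain≤1 (yes _) (yes q) ¬q = ⊥-elim (¬q q)
      gain≤1 (yes _) (no _)  ¬q = ≤-refl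
      gain≤1 (no _)  _       ¬q = <⇒≤ 0<1

      1≤gain : ∀ {a b} {P : Set a} {Q : Set b} (p? : Dec P) (q? : Dec Q) → P → 1# ≤ gainOf p? q?
      1≤gain (yes _) (yes _) p = 1≤1+μ
      1≤gain (yes _) (no _)  p = ≤-refl
      1≤gain (no ¬p) _       p = ⊥-elim (¬p p)

      gain≡1+μ : ∀ {a b} {P : Set a} {Q : Set b} (p? : Dec P) (q? : Dec Q) → P → Q → gainOf p? q? ≡ 1# + μ
      gain≡1+μ (yes _) (yes _) p q = ≡.refl
      gain≡1+μ (yes _) (no ¬q) p q = ⊥-elim (¬q q)
      gain≡1+μ (no ¬p) _       p q = ⊥-elim (¬p p)

    active? : ∀ s a → Dec (0# < Q h L a s)
    active? s a = 0# <? Q h L a s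

    below? : ∀ s a → Dec (h s a < β a)
    below? s a = h s a <? β a

    abstract
      inSimplex : ∀ s → s ℕ.≤ T → InSimplex ε (h s)
      inSimplex zero    _   = initial
      inSimplex (suc s) s<T = IsProjection.inSimplex (update s s<T)

      φ≤h : ∀ s → s ℕ.≤ T → ∀ a → φ ≤ h s a
      φ≤h s s≤T = lower-bound (inSimplex s s≤T)

      0≤h : ∀ s → s ℕ.≤ T → ∀ a → 0# ≤ h s a
      0≤h s s≤T a = ≤-trans (<⇒≤ 0<φ) (φ≤h s s≤T a)

      h≤1 : ∀ s → s ℕ.≤ T → ∀ a → h s a ≤ 1#
      h≤1 s s≤T a = ≤-respʳ (total-one (inSimplex s s≤T)) (summand≤sum (0≤h s s≤T) a)

      someone-above : ∀ s → s ℕ.≤ T → h s i < β i → ∃[ j ] (β j < h s j)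
      someone-above s s≤T hi<βi with Finₚ.any? (λ j → β j <? h s j)
      ... | yes above = above
      ... | no  none  = ⊥-elim (<⇒≰ (<-≤-trans (sum-mono-< i h≤β hi<βi) Σβ≤1)
                          (≤-reflexive (sym (total-one (inSimplex s s≤T)))))
        where
        h≤β : ∀ j → h s j ≤ β j
        h≤β j with h s j ≤? β j
        ... | yes p = p
        ... | no  p = ⊥-elim (none (j , ≰⇒> p))

      factor≤e₂ : ∀ s a → exp (η * gain ε β h L s a) ≤ e₂
      factor≤e₂ s a = exp-mono (*-monoˡ (<⇒≤ 0<η) (gain≤1+μ (active? s a) (below? s a)))

      grows : ∀ {s} → s ℕ.< T → 0# < Q h L i s → h s i < β i → (1# + δ) * h s i ≤ h (suc s) i
      grows {s} s<T 0<Q hi<βi with someone-above s (ℕₚ.<⇒≤ s<T) hi<βi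
      ... | j , βj<hj = MultiplicativeUpdate.Growth.growth R E N
        0<φ (inSimplex s (ℕₚ.<⇒≤ s<T)) (λ a → 0<exp _) (update s s<T) (factor≤e₂ s) 0<κ
        (0<exp _) 1+κ≤e₂ e₁[1+κ]≤e₂ i j
        (≡.cong (λ g → exp (η * g)) (gain≡1+μ (active? s i) (below? s i) 0<Q hi<βi))
        (exp-mono (*-monoˡ (<⇒≤ 0<η) (gain≤1 (active? s j) (below? s j) (λ hj<βj → <⇒≰ βj<hj (<⇒≤ hj<βj)))))
        (≤-trans (e₂φ≤β j) (<⇒≤ βj<hj))

      barely-shrinks : ∀ {s} → s ℕ.< T → 0# < Q h L i s → (1# - κ) * h s i ≤ h (suc s) i
      barely-shrinks {s} s<T 0<Q = MultiplicativeUpdate.stability R E N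
        0<φ (inSimplex s (ℕₚ.<⇒≤ s<T)) (λ a → 0<exp _) (update s s<T) (factor≤e₂ s) 0<κ
        e₂[1-κ]≤e₁ i (exp-mono (*-monoˡ (<⇒≤ 0<η) (1≤gain (active? s i) (below? s i) 0<Q)))

    ρ : Carrier
    ρ = (1# - fromℕ 2 * ε) * β i

    abstract
      0≤ρ : 0# ≤ ρ
      0≤ρ = 0≤x*y (x≤y⇒0≤y-x 2ε≤1) (0≤β i)

      ρ≤β : ρ ≤ β i
      ρ≤β = ≤-by (0≤x*y (0≤x*y (0≤fromℕ 2) (<⇒≤ 0<ε)) (0≤β i))
        (solve 2 (λ e b → b :- (con (+ 1) :- con (+ 2) :* e) :* b := con (+ 2) :* e :* b) refl ε (β i))

      -- The invariant is ρ ≤ h and not β i ≤ h, which can fail, since a user at or above β i has no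
      -- bonus. The slack 2ε in `ρ` absorbs the possible loss κ.
      stays-above : ∀ {s} → s ℕ.< T → 0# < Q h L i s → ρ ≤ h s i → ρ ≤ h (suc s) i
      stays-above {s} s<T 0<Q ρ≤h with h s i <? β i
      ... | yes h<β = ≤-trans ρ≤h (≤-trans
        (≤-by (0≤x*y (<⇒≤ 0<δ) (0≤h s (ℕₚ.<⇒≤ s<T) i))
          (solve 2 (λ d x → (con (+ 1) :+ d) :* x :- x := d :* x) refl δ (h s i)))
        (grows s<T 0<Q h<β))
      ... | no  h≮β = begin
        (1# - fromℕ 2 * ε) * β i   ≤⟨ *-monoʳ (0≤β i) (≤-by (x≤y⇒0≤y-x κ≤2ε)
                                        (solve 2 (λ k e → con (+ 1) :- k :- (con (+ 1) :- con (+ 2) :* e) := con (+ 2) :* e :- k) refl κ ε)) ⟩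
        (1# - κ) * β i             ≤⟨ *-monoˡ (x≤y⇒0≤y-x (≤-trans κ≤2ε 2ε≤1)) β≤h ⟩
        (1# - κ) * h s i           ≤⟨ barely-shrinks s<T 0<Q ⟩
        h (suc s) i                ∎
        where
        open ≤-Reasoning
        β≤h : β i ≤ h s i
        β≤h with β i ≤? h s i
        ... | yes p = p
        ... | no  p = ⊥-elim (h≮β (≰⇒> p))

    share : ℕ → ℕ → Carrier
    share s m = Σ< (λ j → h (s ℕ.+ suc j) i) m

    -- After m active steps, k of them count as a warm-up during which the
    -- allocation grew geometrically; all others received at least ρ.
    record WarmUp (s m k : ℕ) : Set (c Level.⊔ ℓ₁ Level.⊔ ℓ₂) where
      field
        short   : ∀ j → j ℕ.< k → φ * (1# + δ) ^ j ≤ 1#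
        payoff  : fromℕ m * ρ ≤ share s m + fromℕ k * ρ
        -- The second case, in which every step so far was warm-up, carries the geometric lower
        -- bound; the first case, once reached, persists by `stays-above`.
        current : ρ ≤ h (s ℕ.+ suc m) i ⊎ (k ≡ m × φ * (1# + δ) ^ m ≤ h (s ℕ.+ suc m) i)

    open WarmUp

    abstract
      warm-up : ∀ {s} m → s ℕ.+ suc m ℕ.≤ T → BusySince h L i s (suc m) → ∃[ k ] WarmUp s m k
      warm-up {s} zero s+1≤T _ = 0 , record
        { short   = λ _ ()
        ; payoff  = ≤-reflexive (sym (+-identityˡ _))
        -- At `s` the user was inactive and may have lost share, so growth is counted from s + 1,
        -- where only the floor is known.
        ; current = inj₂ (≡.refl , ≤-respˡ (sym (*-identityʳ φ)) (φ≤h (s ℕ.+ 1) s+1≤T i))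
        }
      warm-up {s} (suc m) s+2+m≤T (Q≈0 , busy) =
        step (warm-up m (ℕₚ.<⇒≤ now<T) (Q≈0 , λ j j<1+m → busy j (ℕₚ.m<n⇒m<1+n j<1+m)))
        where
        now : ℕ
        now = s ℕ.+ suc m

        next≡ : s ℕ.+ suc (suc m) ≡ suc now
        next≡ = ℕₚ.+-suc s (suc m)

        now<T : now ℕ.< T
        now<T = ≡.subst (ℕ._≤ T) next≡ s+2+m≤T

        0<Q : 0# < Q h L i now
        0<Q = busy m (ℕₚ.m<n⇒m<1+n (ℕₚ.n<1+n m))

        toNext : ∀ {x} → x ≤ h (suc now) i → x ≤ h (s ℕ.+ suc (suc m)) i
        toNext {x} = ≡.subst (λ t → x ≤ h t i) (≡.sym next≡)

        share-suc : share s (suc m) ≈ share s m + h now i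
        share-suc = Σ<-suc (λ j → h (s ℕ.+ suc j) i) m

        warm : ∀ {k} → WarmUp s m k → ρ ≤ h now i → WarmUp s (suc m) k
        warm {k} W ρ≤h = record
          { short   = short W
          ; payoff  = begin
              (1# + fromℕ m) * ρ                     ≈⟨ solve 2 (λ m r → (con (+ 1) :+ m) :* r := m :* r :+ r) refl (fromℕ m) ρ ⟩
              fromℕ m * ρ + ρ                        ≤⟨ +-mono (payoff W) ρ≤h ⟩
              share s m + fromℕ k * ρ + h now i      ≈⟨ solve 3 (λ a b c → a :+ b :+ c := a :+ c :+ b) refl (share s m) (fromℕ k * ρ) (h now i) ⟩
              share s m + h now i + fromℕ k * ρ      ≈⟨ +-congʳ share-suc ⟨
              share s (suc m) + fromℕ k * ρ          ∎
          ; current = inj₁ (toNext (stays-above now<T 0<Q ρ≤h))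
          }
          where open ≤-Reasoning

        cold : WarmUp s m m → φ * (1# + δ) ^ m ≤ h now i → h now i < ρ → WarmUp s (suc m) (suc m)
        cold W growing h<ρ = record
          { short   = λ j j<1+m →
                      [ short W j , (λ { ≡.refl → ≤-trans growing (h≤1 now (ℕₚ.<⇒≤ now<T) i) }) ]′
                      (ℕₚ.m<1+n⇒m<n∨m≡n j<1+m)
          -- All m + 1 steps count as warm-up, so the claim is only that the shares are nonnegative.
          ; payoff  = ≤-by (Σ<-0≤ (suc m) λ j j<1+m →
                        0≤h (s ℕ.+ suc j) (ℕₚ.≤-trans (ℕₚ.+-monoʳ-≤ s j<1+m) (ℕₚ.<⇒≤ now<T)) i)
                      (solve 2 (λ a b → a :+ b :- b := a) refl (share s (suc m)) (fromℕ (suc m) * ρ))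
          ; current = inj₂ (≡.refl , toNext (begin
              φ * ((1# + δ) * (1# + δ) ^ m)    ≈⟨ solve 3 (λ f d p → f :* (d :* p) := d :* (f :* p)) refl φ (1# + δ) ((1# + δ) ^ m) ⟩
              (1# + δ) * (φ * (1# + δ) ^ m)    ≤⟨ *-monoˡ (<⇒≤ 0<1+δ) growing ⟩
              (1# + δ) * h now i               ≤⟨ grows now<T 0<Q (<-≤-trans h<ρ ρ≤β) ⟩
              h (suc now) i                    ∎))
          }
          where open ≤-Reasoning

        step : ∃[ k ] WarmUp s m k → ∃[ k ] WarmUp s (suc m) k
        step (k , W) with ρ ≤? h now i
        ... | yes ρ≤h = k , warm W ρ≤h
        ... | no  ρ≰h with current W
        ...   | inj₁ ρ≤h            = ⊥-elim (ρ≰h ρ≤h)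
        ...   | inj₂ (≡.refl , growing) = suc m , cold W growing (≰⇒> ρ≰h)

      warm-up-short : ∀ {s m k} → WarmUp s m k → fromℕ (suc k) ≤ p
      warm-up-short {k = zero}  W = ≤-respˡ (sym (+-identityʳ 1#)) 1≤p
      warm-up-short {k = suc j} W = growth-time j (short W j (ℕₚ.n<1+n j))

      -- The extra 1 in suc k accounts for the step s at which the user was still inactive.
      busy-share : ∀ {s m} → s ℕ.+ suc m ℕ.≤ T → BusySince h L i s (suc m) →
        ∃[ k ] (fromℕ (suc k) ≤ p × fromℕ m * ρ ≤ Σ< (λ j → h (s ℕ.+ j) i) (suc m) + fromℕ k * ρ)
      busy-share {s} {m} s+1+m≤T busy with warm-up m s+1+m≤T busy
      ... | k , W = k , warm-up-short W , ≤-trans (payoff W) (≤-by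
        (0≤h (s ℕ.+ 0) (ℕₚ.≤-trans (ℕₚ.+-monoʳ-≤ s ℕ.z≤n) s+1+m≤T) i)
        (solve 3 (λ x a b → x :+ a :+ b :- (a :+ b) := x) refl (h (s ℕ.+ 0) i) (share s m) (fromℕ k * ρ)))

    -- Comparison with the competing allocation.

    module Comparison (0≤L : ∀ s → s ℕ.< T → ∀ a → 0# ≤ L s a)
                      (h′ : Allocations) (h′≈ρ : ∀ s → s ℕ.< T → h′ s i ≈ ρ) where

      w w′ arrivals : Seq
      w  = W h L i
      w′ = W h′ L i
      arrivals s = L s i

      abstract
        0≤p : 0# ≤ p
        0≤p = ≤-trans (<⇒≤ 0<1) 1≤p

        0≤w : ∀ s → s ℕ.< T → 0# ≤ w s
        0≤w s s<T = 0≤W h L i (0≤h s (ℕₚ.<⇒≤ s<T) i) (0≤L s s<T i)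

        w′-share : ∀ s q → s ℕ.+ q ℕ.≤ T → Σ< w′ (s ℕ.+ q) ≤ Σ< arrivals s + fromℕ q * ρ
        w′-share s q s+q≤T = work-≤-share h′ L i s q λ j j<q →
          h′≈ρ (s ℕ.+ j) (ℕₚ.<-≤-trans (ℕₚ.+-monoʳ-< s j<q) s+q≤T)

        -- With an empty queue nothing is missing. Otherwise both sides are measured from the loads
        -- before the busy period: the competitor adds at most m + 1 times ρ, the algorithm at least
        -- m - k times ρ, and (k + 1)ρ ≤ β i * p.
        bounded-loss : ∀ t → t ℕ.≤ T → Σ< w′ t - β i * p ≤ Σ< w t
        bounded-loss t t≤T with busy-period h L i t
        ... | s , zero , ≡.refl , busy = ≤-by
          (0≤x+y (x≤y⇒0≤y-x (≤-trans (ΣW≤ΣF h′ L i (s ℕ.+ 0)) (≤-reflexive Σw≈ΣF))) (0≤x*y (0≤β i) 0≤p))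
          (solve 3 (λ a b c → a :- (b :- c) := a :- b :+ c) refl (Σ< w (s ℕ.+ 0)) (Σ< w′ (s ℕ.+ 0)) (β i * p))
          where
          Σw≈ΣF : Σ< arrivals (s ℕ.+ 0) ≈ Σ< w (s ℕ.+ 0)
          Σw≈ΣF = sym (trans (busy-work h L i {s} busy) (trans (+-identityʳ _)
            (reflexive (≡.cong (Σ< arrivals) (≡.sym (ℕₚ.+-identityʳ s))))))
        ... | s , suc m , ≡.refl , busy with busy-share {s} t≤T busy
        ...   | k , 1+k≤p , mρ≤ = begin
          Σ< w′ (s ℕ.+ suc m) - β i * p
            ≤⟨ +-mono (w′-share s (suc m) t≤T) (≤-by
                 (x≤y⇒0≤y-x (≤-trans (*-monoˡ (0≤fromℕ (suc k)) ρ≤β)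
                   (≤-respʳ (*-comm p (β i)) (*-monoʳ (0≤β i) 1+k≤p))))
                 (solve 2 (λ a b → :- a :- (:- b) := b :- a) refl (fromℕ (suc k) * ρ) (β i * p))) ⟩
          Σ< arrivals s + fromℕ (suc m) * ρ - fromℕ (suc k) * ρ
            ≤⟨ ≤-by (x≤y⇒0≤y-x mρ≤)
                 (solve 5 (λ f m k r a → f :+ a :- (f :+ (con (+ 1) :+ m) :* r :- (con (+ 1) :+ k) :* r)
                      := a :+ k :* r :- m :* r) refl (Σ< arrivals s) (fromℕ m) (fromℕ k) ρ (Σ< (λ j → h (s ℕ.+ j) i) (suc m))) ⟩
          Σ< arrivals s + Σ< (λ j → h (s ℕ.+ j) i) (suc m)
            ≈⟨ busy-work h L i {s} busy ⟨
          Σ< w (s ℕ.+ suc m) ∎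
          where open ≤-Reasoning

        -- The integer part of `p`, found by descending from a known upper bound.
        floor-below : ∀ M → p < fromℕ M → ∃[ K ] (fromℕ K ≤ p × p < fromℕ (suc K))
        floor-below zero    p<0 = ⊥-elim (<⇒≰ p<0 0≤p)
        floor-below (suc M) p<1+M with fromℕ M ≤? p
        ... | yes M≤p = M , M≤p , p<1+M
        ... | no  M≰p = floor-below M (≰⇒> M≰p)

        -- The busy period around t + K decides. If it starts at s ≥ t, the loads before t are all
        -- served by s. If it starts at s = t - q, the algorithm has q + K steps since s in which to
        -- match the competitor's q; at most k + 1 ≤ K of them are lost.
        delayed-work : ∀ t K → t ℕ.+ K ℕ.≤ T → p < fromℕ (suc K) → Σ< w′ t ≤ Σ< w (t ℕ.+ K)
        delayed-work t K t+K≤T p<1+K with busy-period h L i (t ℕ.+ K)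
        ... | s , n , s+n≡t+K , busy with t ℕₚ.≤? s
        ...   | yes t≤s = begin
          Σ< w′ t        ≤⟨ ΣW≤ΣF h′ L i t ⟩
          Σ< arrivals t         ≤⟨ Σ<-extend t≤s (λ j j<s → 0≤L j (ℕₚ.<-≤-trans j<s (ℕₚ.≤-trans s≤t+K t+K≤T)) i) ⟩
          Σ< arrivals s         ≈⟨ trans (sym (work-balance h L i s)) (trans (+-congˡ (proj₁ busy)) (+-identityʳ _)) ⟩
          Σ< w s         ≤⟨ Σ<-extend s≤t+K (λ j j<t+K → 0≤w j (ℕₚ.<-≤-trans j<t+K t+K≤T)) ⟩
          Σ< w (t ℕ.+ K) ∎
          where
          open ≤-Reasoning
          s≤t+K : s ℕ.≤ t ℕ.+ K
          s≤t+K = ≡.subst (s ℕ.≤_) s+n≡t+K (ℕₚ.m≤m+n s n)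
        delayed-work t K t+K≤T p<1+K | s , zero , s+0≡t+K , busy | no t≰s =
          ⊥-elim (t≰s (≡.subst (t ℕ.≤_) (≡.trans (≡.sym s+0≡t+K) (ℕₚ.+-identityʳ s)) (ℕₚ.m≤m+n t K)))
        delayed-work t K t+K≤T p<1+K | s , suc m , s+1+m≡t+K , busy | no t≰s
          with ℕₚ.m≤n⇒∃[o]m+o≡n (ℕₚ.<⇒≤ (ℕₚ.≰⇒> t≰s))
        ... | q , ≡.refl with busy-share {s} (≡.subst (ℕ._≤ T) (≡.sym s+1+m≡t+K) t+K≤T) busy
        ...   | k , 1+k≤p , mρ≤ = begin
          Σ< w′ (s ℕ.+ q)
            ≤⟨ w′-share s q (ℕₚ.≤-trans (ℕₚ.m≤m+n (s ℕ.+ q) K) t+K≤T) ⟩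
          Σ< arrivals s + fromℕ q * ρ
            ≤⟨ ≤-by (0≤x+y (x≤y⇒0≤y-x mρ≤) (0≤x*y (x≤y⇒0≤y-x q+k≤m) 0≤ρ))
                 (solve 6 (λ f q r a m k → f :+ a :- (f :+ q :* r) := a :+ k :* r :- m :* r :+ (m :- (q :+ k)) :* r) refl
                    (Σ< arrivals s) (fromℕ q) ρ (Σ< (λ j → h (s ℕ.+ j) i) (suc m)) (fromℕ m) (fromℕ k)) ⟩
          Σ< arrivals s + Σ< (λ j → h (s ℕ.+ j) i) (suc m)
            ≈⟨ busy-work h L i {s} busy ⟨
          Σ< w (s ℕ.+ suc m)
            ≡⟨ ≡.cong (Σ< w) s+1+m≡t+K ⟩
          Σ< w (s ℕ.+ q ℕ.+ K) ∎
          where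
          open ≤-Reasoning
          open Algebra.Properties.Semiring.Mult semiring using (×-homo-+)
          k<K : k ℕ.< K
          k<K with suc k ℕₚ.≤? K
          ... | yes k<K = k<K
          ... | no  k≮K = ⊥-elim (<⇒≰ (≤-<-trans 1+k≤p p<1+K) (fromℕ-mono (ℕₚ.≰⇒> k≮K)))
          1+m≡q+K : suc m ≡ q ℕ.+ K
          1+m≡q+K = ℕₚ.+-cancelˡ-≡ s (suc m) (q ℕ.+ K) (≡.trans s+1+m≡t+K (ℕₚ.+-assoc s q K))
          -- Since m + 1 = q + K and k < K, the m - k well-paid steps are at least q.
          q+k≤m : fromℕ q + fromℕ k ≤ fromℕ m
          q+k≤m = ≤-respˡ (×-homo-+ 1# q k) (fromℕ-mono (ℕ.s≤s⁻¹ (≡.subst (suc (q ℕ.+ k) ℕ.≤_) (≡.sym 1+m≡q+K)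
            (ℕₚ.≤-trans (ℕₚ.≤-reflexive (≡.sym (ℕₚ.+-suc q k))) (ℕₚ.+-monoʳ-≤ q k<K)))))

        Σ<≤sumUpTo : ∀ {f x r} → r ℕ.≤ T → (∀ s → s ℕ.< T → 0# ≤ f s) → fromℕ r ≤ x → Σ< f r ≤ sumUpTo T x f
        Σ<≤sumUpTo {f} {x} {r} r≤T 0≤f r≤x = ≤-trans
          (Σ<-mono r λ s s<r → selected s (fromℕ (suc s) ≤? x) (≤-trans (fromℕ-mono s<r) r≤x))
          (Σ<-extend r≤T λ s s<T → nonneg s (fromℕ (suc s) ≤? x) (0≤f s s<T))
          where
          selected : ∀ s (d : Dec (fromℕ (suc s) ≤ x)) → fromℕ (suc s) ≤ x → f s ≤ (if does d then f s else 0#)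
          selected s (yes _) _ = ≤-refl
          selected s (no ¬p) p = ⊥-elim (¬p p)
          nonneg : ∀ s (d : Dec (fromℕ (suc s) ≤ x)) → 0# ≤ f s → 0# ≤ (if does d then f s else 0#)
          nonneg s (yes _) 0≤fs = 0≤fs
          nonneg s (no _)  _    = ≤-refl

        bounded-delay : ∀ t → 1 ℕ.≤ t → fromℕ t ≤ fromℕ T - p → Σ< w′ t ≤ sumUpTo T (fromℕ t + p) w
        bounded-delay t@(suc u) 1≤t t≤T-p with floor-below T p<T
          where
          -- Because t ≥ 1, the bound t ≤ T - p puts `p` strictly below T, where the search for its
          -- integer part can start.
          p<T : p < fromℕ T
          p<T = <-by (0<x+y 0<1 (0≤x+y (0≤fromℕ u) (x≤y⇒0≤y-x t≤T-p)))
            (solve 3 (λ T p u → T :- p := con (+ 1) :+ (u :+ (T :- p :- (con (+ 1) :+ u)))) refl (fromℕ T) p (fromℕ u))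
        ... | K , K≤p , p<1+K = ≤-trans (delayed-work t K t+K≤T p<1+K) (Σ<≤sumUpTo t+K≤T 0≤w t+K≤t+p)
          where
          open Algebra.Properties.Semiring.Mult semiring using (×-homo-+)
          t+K≤t+p : fromℕ (t ℕ.+ K) ≤ fromℕ t + p
          t+K≤t+p = ≤-respˡ (sym (×-homo-+ 1# t K)) (+-mono ≤-refl K≤p)
          t+K≤T : t ℕ.+ K ℕ.≤ T
          t+K≤T = fromℕ-cancel (≤-trans t+K≤t+p (≤-by (x≤y⇒0≤y-x t≤T-p)
            (solve 3 (λ T p t → T :- (t :+ p) := T :- p :- t) refl (fromℕ T) p (fromℕ t))))

theorem4 : ∀ {c ℓ₁ ℓ₂ : Level} (R : RealNumbers c ℓ₁ ℓ₂) (E : ExpLog R) (N : ℕ) →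
    let open RealNumbers R
        open ExpLog E
        open Allocation R E N
    in
    2 ℕ.≤ N →
    ∀ (ε η : Carrier) →
    0# < ε → ε ≤ 1# / fromℕ 10 →
    0# < η → η ≤ 1# / fromℕ 3 →
    ∀ (β : Fin N → Carrier) →
    (∀ i → 0# ≤ β i) →
    (∑[ i < N ] β i) ≤ 1# →
    (∀ i → exp (η * (1# + bonus ε)) * (ε / fromℕ N) ≤ β i) →
    ∀ (T : ℕ) (L : Loads) →
    (∀ s → s ℕ.< T → ∀ i → 0# ≤ L s i) →
    ∀ (h : Allocations) → IsRun ε η β L T h →
    ∀ (i : Fin N) (h′ : Allocations) →
    (∀ s → s ℕ.< T → ∀ j → (0# ≤ h′ s j) × (h′ s j ≤ 1#)) →
    (∀ s → s ℕ.< T → h′ s i ≈ (1# - fromℕ 2 * ε) * β i) →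
    (∀ (t : ℕ) → 1 ℕ.≤ t → fromℕ t ≤ fromℕ T - delay ε η →
       (∑[ s < t ] work h′ L (toℕ s) i)
         ≤ sumUpTo T (fromℕ t + delay ε η) (λ s → work h L s i))
    ×
    (∀ (t : ℕ) → 1 ℕ.≤ t → t ℕ.≤ T →
       (∑[ s < t ] work h′ L (toℕ s) i) - β i * delay ε η
         ≤ (∑[ s < t ] work h L (toℕ s) i))
theorem4 R E N 2≤N ε η 0<ε ε≤1/10 0<η η≤1/3 β 0≤β Σβ≤1 e₂φ≤β T L 0≤L h run i h′ _ h′≈ρ =
  bounded-delay , λ t _ t≤T → bounded-loss t t≤T
  where
  open Run R E N 2≤N ε η 0<ε ε≤1/10 0<η η≤1/3 β 0≤β Σβ≤1 e₂φ≤β T L h run i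
  open Comparison 0≤L h′ h′≈ρ
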